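{- Over $\mathrm{ACA}_0$, weak Martin's pointed tree theorem $\mathrm{wMPT}$ does not imply $\mathrm{ATR}_0$; that is, $\mathrm{ACA}_0+\mathrm{wMPT}\not\vdash \mathrm{ATR}_0$.
   Context: All theories are in the language of second order arithmetic, with models $(N,M,0,1,+,\times,<)$, where $N$ is the number sort and $M$ is the sort of sets of numbers (equivalently, up to coding, functions from numbers to numbers, called reals). $\mathrm{ACA}_0$ is the usual system including all arithmetical comprehension axioms, and $\mathrm{ATR}_0$ is the usual system of arithmetical transfinite recursion. $\leq_{\rm T}$ denotes Turing reducibility. A tree $T\subseteq\omega^{<\omega}$ is a set of finite strings closed under initial segments; $[T]$ is the collection of its infinite paths. A perfect tree is a nonempty tree in which every node has two incompatible extensions in the tree. A set $A$ of reals is cofinal if for every real $x$ there is some $y\in A$ with $y\geq_{\rm T} x$. Weak Martin's pointed tree theorem, $\mathrm{wMPT}$, is the statement (formulated in second order arithmetic): for every tree $T\subseteq\omega^{<\omega}$, if $[T]$ is cofinal, then $T$ has a perfect subtree. -}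

module Defs where

open import Data.Fin.Base using (Fin; zero; suc; _↑ʳ_; lift)
open import Data.List.Base using (List; []; _∷_; map)
open import Data.List.Membership.Propositional using () renaming (_∈_ to _∈ₗ_)
open import Data.Nat.Base using (ℕ; zero; suc; _+_)
open import Function.Base using (id; _∘_)
open import Level using (0ℓ)
open import Relation.Unary using (Pred; _∈_)

private
  variable
    n n′ m m′ : ℕ

------------------------------------------------------------------------
-- The language of second order arithmetic.  Well-scoped de Bruijn
-- indices: n counts the number variables and m the set variables in scope.

infix  10 _↑_
infixl 9  _⊗_
infixl 8  _⊕_
infix  7  _≐_ _≺_ _ε_ _⊑_ _⊆̇_ _≤T_ _≤⟨_⟩_ _<⟨_⟩_ _∈field_
infix  6  ¬̇_
infixr 5  _∧_
infixr 4  _∨_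
infixr 3  _⇒_
infix  3  _⇔_
infixr 2  ∀ⁿ_ ∀ˢ_ ∃ⁿ_ ∃ˢ_

data Term (n : ℕ) : Set where
  var     : Fin n → Term n
  𝟎 𝟏     : Term n
  _⊕_ _⊗_ : Term n → Term n → Term n

data Formula (n m : ℕ) : Set where
  _≐_ _≺_ : Term n → Term n → Formula n m
  _ε_     : Term n → Fin m → Formula n m
  ⊥̇       : Formula n m
  _⇒_ _∧_ : Formula n m → Formula n m → Formula n m
  ∀ⁿ_     : Formula (suc n) m → Formula n m
  ∀ˢ_     : Formula n (suc m) → Formula n m

-- The logic is classical, so the other connectives are abbreviations.

¬̇_ : Formula n m → Formula n m
¬̇ φ = φ ⇒ ⊥̇

_∨_ _⇔_ : Formula n m → Formula n m → Formula n m
φ ∨ ψ = ¬̇ φ ⇒ ψ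
φ ⇔ ψ = (φ ⇒ ψ) ∧ (ψ ⇒ φ)

∃ⁿ_ : Formula (suc n) m → Formula n m
∃ⁿ φ = ¬̇ (∀ⁿ ¬̇ φ)

∃ˢ_ : Formula n (suc m) → Formula n m
∃ˢ φ = ¬̇ (∀ˢ ¬̇ φ)

data Arithmetical {n m : ℕ} : Formula n m → Set where
  _≐_ : (s t : Term n) → Arithmetical (s ≐ t)
  _≺_ : (s t : Term n) → Arithmetical (s ≺ t)
  _ε_ : (t : Term n) (X : Fin m) → Arithmetical (t ε X)
  ⊥̇   : Arithmetical ⊥̇
  _⇒_ : {φ ψ : Formula n m} → Arithmetical φ → Arithmetical ψ → Arithmetical (φ ⇒ ψ)
  _∧_ : {φ ψ : Formula n m} → Arithmetical φ → Arithmetical ψ → Arithmetical (φ ∧ ψ)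
  ∀ⁿ_ : {φ : Formula (suc n) m} → Arithmetical φ → Arithmetical (∀ⁿ φ)

------------------------------------------------------------------------
-- Substitution: terms for number variables, set variables for set variables.

subᵗ : (Fin n → Term n′) → Term n → Term n′
subᵗ σ (var i) = σ i
subᵗ σ 𝟎       = 𝟎
subᵗ σ 𝟏       = 𝟏
subᵗ σ (s ⊕ t) = subᵗ σ s ⊕ subᵗ σ t
subᵗ σ (s ⊗ t) = subᵗ σ s ⊗ subᵗ σ t

_↑_ : Term n → (k : ℕ) → Term (k + n)
t ↑ k = subᵗ (var ∘ (k ↑ʳ_)) t

liftᵗ : (Fin n → Term n′) → Fin (suc n) → Term (suc n′)
liftᵗ σ zero    = var zero
liftᵗ σ (suc i) = σ i ↑ 1

sub : (Fin n → Term n′) → (Fin m → Fin m′) → Formula n m → Formula n′ m′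
sub σ ρ (s ≐ t) = subᵗ σ s ≐ subᵗ σ t
sub σ ρ (s ≺ t) = subᵗ σ s ≺ subᵗ σ t
sub σ ρ (t ε X) = subᵗ σ t ε ρ X
sub σ ρ ⊥̇       = ⊥̇
sub σ ρ (φ ⇒ ψ) = sub σ ρ φ ⇒ sub σ ρ ψ
sub σ ρ (φ ∧ ψ) = sub σ ρ φ ∧ sub σ ρ ψ
sub σ ρ (∀ⁿ φ)  = ∀ⁿ sub (liftᵗ σ) ρ φ
sub σ ρ (∀ˢ φ)  = ∀ˢ sub σ (lift 1 ρ) φ

wkⁿ : Formula n m → Formula (suc n) m
wkⁿ = sub (var ∘ suc) id

wkˢ : Formula n m → Formula n (suc m)
wkˢ = sub var suc

_[_]ⁿ : Formula (suc n) m → Term n → Formula n m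
φ [ t ]ⁿ = sub (λ { zero → t ; (suc i) → var i }) id φ

_[_]ˢ : Formula n (suc m) → Fin m → Formula n m
φ [ X ]ˢ = sub var (λ { zero → X ; (suc i) → i }) φ

------------------------------------------------------------------------
-- Theories and provability: natural deduction for classical two-sorted
-- first order logic with equality between numbers.

Sentence : Set
Sentence = Formula 0 0

Theory : Set₁
Theory = Pred Sentence 0ℓ

embed : Sentence → Formula n m
embed = sub (λ ()) (λ ())

-- No set term exists in an empty context, so the calculus by itself does not
-- force the set sort to be inhabited; comprehension axioms do.

infix 1 _∣_⊢_ _⊢_

data _∣_⊢_ (T : Theory) {n m : ℕ} (Γ : List (Formula n m)) : Formula n m → Set where
  axiom   : {φ : Sentence} → φ ∈ T → T ∣ Γ ⊢ embed φ
  assume  : {φ : Formula n m} → φ ∈ₗ Γ → T ∣ Γ ⊢ φ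
  ⇒-intro : {φ ψ : Formula n m} → T ∣ φ ∷ Γ ⊢ ψ → T ∣ Γ ⊢ φ ⇒ ψ
  ⇒-elim  : {φ ψ : Formula n m} → T ∣ Γ ⊢ φ ⇒ ψ → T ∣ Γ ⊢ φ → T ∣ Γ ⊢ ψ
  ∧-intro : {φ ψ : Formula n m} → T ∣ Γ ⊢ φ → T ∣ Γ ⊢ ψ → T ∣ Γ ⊢ φ ∧ ψ
  ∧-elimˡ : {φ ψ : Formula n m} → T ∣ Γ ⊢ φ ∧ ψ → T ∣ Γ ⊢ φ
  ∧-elimʳ : {φ ψ : Formula n m} → T ∣ Γ ⊢ φ ∧ ψ → T ∣ Γ ⊢ ψ
  raa     : {φ : Formula n m} → T ∣ ¬̇ φ ∷ Γ ⊢ ⊥̇ → T ∣ Γ ⊢ φ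
  ∀ⁿ-intro : {φ : Formula (suc n) m} → T ∣ map wkⁿ Γ ⊢ φ → T ∣ Γ ⊢ ∀ⁿ φ
  ∀ⁿ-elim  : {φ : Formula (suc n) m} → T ∣ Γ ⊢ ∀ⁿ φ → (t : Term n) → T ∣ Γ ⊢ φ [ t ]ⁿ
  ∀ˢ-intro : {φ : Formula n (suc m)} → T ∣ map wkˢ Γ ⊢ φ → T ∣ Γ ⊢ ∀ˢ φ
  ∀ˢ-elim  : {φ : Formula n (suc m)} → T ∣ Γ ⊢ ∀ˢ φ → (X : Fin m) → T ∣ Γ ⊢ φ [ X ]ˢ
  ≐-refl  : (t : Term n) → T ∣ Γ ⊢ t ≐ t
  ≐-subst : (φ : Formula (suc n) m) {s t : Term n} →
            T ∣ Γ ⊢ s ≐ t → T ∣ Γ ⊢ φ [ s ]ⁿ → T ∣ Γ ⊢ φ [ t ]ⁿ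

_⊢_ : Theory → Sentence → Set
T ⊢ φ = T ∣ [] ⊢ φ

_Proves_ : Theory → Theory → Set
T Proves U = ∀ {φ} → φ ∈ U → T ⊢ φ

∀*ˢ : (m : ℕ) → Formula 0 m → Sentence
∀*ˢ zero    φ = φ
∀*ˢ (suc m) φ = ∀*ˢ m (∀ˢ φ)

∀*_ : Formula n m → Sentence
∀*_ {zero}  {m} φ = ∀*ˢ m φ
∀*_ {suc n} {m} φ = ∀* (∀ⁿ φ)

------------------------------------------------------------------------
-- ACA₀

x₀ : Term (1 + n)
x₀ = var zero

x₁ : Term (2 + n)
x₁ = x₀ ↑ 1

x₂ : Term (3 + n)
x₂ = x₀ ↑ 2

x₃ : Term (4 + n)
x₃ = x₀ ↑ 3

x₄ : Term (5 + n)
x₄ = x₀ ↑ 4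

x₅ : Term (6 + n)
x₅ = x₀ ↑ 5

x₆ : Term (7 + n)
x₆ = x₀ ↑ 6

X₀ : Fin (1 + m)
X₀ = zero

X₁ : Fin (2 + m)
X₁ = suc zero

data ACA₀ : Theory where
  +1≢0   : ACA₀ (∀ⁿ ¬̇ x₀ ⊕ 𝟏 ≐ 𝟎)
  +1-inj : ACA₀ (∀ⁿ ∀ⁿ x₁ ⊕ 𝟏 ≐ x₀ ⊕ 𝟏 ⇒ x₁ ≐ x₀)
  ⊕-zero : ACA₀ (∀ⁿ x₀ ⊕ 𝟎 ≐ x₀)
  ⊕-suc  : ACA₀ (∀ⁿ ∀ⁿ x₁ ⊕ (x₀ ⊕ 𝟏) ≐ (x₁ ⊕ x₀) ⊕ 𝟏)
  ⊗-zero : ACA₀ (∀ⁿ x₀ ⊗ 𝟎 ≐ 𝟎)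
  ⊗-suc  : ACA₀ (∀ⁿ ∀ⁿ x₁ ⊗ (x₀ ⊕ 𝟏) ≐ x₁ ⊗ x₀ ⊕ x₁)
  ≺-zero : ACA₀ (∀ⁿ ¬̇ x₀ ≺ 𝟎)
  ≺-suc  : ACA₀ (∀ⁿ ∀ⁿ x₁ ≺ x₀ ⊕ 𝟏 ⇔ x₁ ≺ x₀ ∨ x₁ ≐ x₀)
  induction : ACA₀ (∀ˢ 𝟎 ε X₀ ∧ (∀ⁿ x₀ ε X₀ ⇒ x₀ ⊕ 𝟏 ε X₀) ⇒ (∀ⁿ x₀ ε X₀))
  comprehension : ∀ {n m} (φ : Formula (suc n) m) → Arithmetical φ →
                  ACA₀ (∀* (∃ˢ ∀ⁿ x₀ ε X₀ ⇔ wkˢ φ))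

------------------------------------------------------------------------
-- Pairs, relations and functions.  A function is the set of codes of the
-- pairs in its graph; it contains nothing else.

-- An injection N × N → N.
⟨_,_⟩ : Term n → Term n → Term n
⟨ s , t ⟩ = (s ⊕ t) ⊗ (s ⊕ t) ⊕ s

Relation : Fin m → Formula n m
Relation R = ∀ⁿ x₀ ε R ⇒ (∃ⁿ ∃ⁿ x₂ ≐ ⟨ x₁ , x₀ ⟩)

Function : Fin m → Formula n m
Function F = Relation F
           ∧ (∀ⁿ ∃ⁿ ⟨ x₁ , x₀ ⟩ ε F)
           ∧ (∀ⁿ ∀ⁿ ∀ⁿ ⟨ x₂ , x₁ ⟩ ε F ∧ ⟨ x₂ , x₀ ⟩ ε F ⇒ x₁ ≐ x₀)

------------------------------------------------------------------------
-- Finite sequences, by Gödel's β-function: ⟨ l , ⟨ a , d ⟩ ⟩ codes the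
-- sequence of length l with i-th entry a mod (1 + d (i + 1)).

Code : Term n → Formula n m
Code s = ∃ⁿ ∃ⁿ ∃ⁿ s ↑ 3 ≐ ⟨ x₂ , ⟨ x₁ , x₀ ⟩ ⟩

-- i is less than the length of s, and the i-th entry of s is v.
Entry : Term n → Term n → Term n → Formula n m
Entry s i v = ∃ⁿ ∃ⁿ ∃ⁿ ∃ⁿ
    s ↑ 4 ≐ ⟨ x₃ , ⟨ x₂ , x₁ ⟩ ⟩
  ∧ i ↑ 4 ≺ x₃
  ∧ x₂ ≐ x₀ ⊗ (𝟏 ⊕ x₁ ⊗ (i ↑ 4 ⊕ 𝟏)) ⊕ v ↑ 4
  ∧ v ↑ 4 ≺ 𝟏 ⊕ x₁ ⊗ (i ↑ 4 ⊕ 𝟏)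

-- For sequences, inclusion of graphs is the initial segment relation.
_⊑_ : Term n → Term n → Formula n m
s ⊑ t = ∀ⁿ ∀ⁿ Entry (s ↑ 2) x₁ x₀ ⇒ Entry (t ↑ 2) x₁ x₀

-- The least code of a sequence is the string; strings are equal as
-- sequences only if they are equal as numbers.
String : Term n → Formula n m
String s = Code s ∧ (∀ⁿ x₀ ≺ s ↑ 1 ∧ Code x₀ ⇒ ¬̇ (x₀ ⊑ s ↑ 1 ∧ s ↑ 1 ⊑ x₀))

------------------------------------------------------------------------
-- Trees

Tree : Fin m → Formula n m
Tree T = (∀ⁿ x₀ ε T ⇒ String x₀)
       ∧ (∀ⁿ ∀ⁿ x₁ ε T ∧ String x₀ ∧ x₀ ⊑ x₁ ⇒ x₀ ε T)

Perfect : Fin m → Formula n m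
Perfect T = Tree T
          ∧ (∃ⁿ x₀ ε T)
          ∧ (∀ⁿ x₀ ε T ⇒ (∃ⁿ ∃ⁿ x₁ ε T ∧ x₀ ε T ∧ x₂ ⊑ x₁ ∧ x₂ ⊑ x₀
                               ∧ ¬̇ (x₁ ⊑ x₀) ∧ ¬̇ (x₀ ⊑ x₁)))

_⊆̇_ : Fin m → Fin m → Formula n m
S ⊆̇ T = ∀ⁿ x₀ ε S ⇒ x₀ ε T

-- F ∈ [T].
Path : Fin m → Fin m → Formula n m
Path F T = Function F
         ∧ (∀ⁿ String x₀ ∧ (∀ⁿ ∀ⁿ Entry x₂ x₁ x₀ ⇒ ⟨ x₁ , x₀ ⟩ ε F) ⇒ x₀ ε T)

------------------------------------------------------------------------
-- Turing reducibility, by register machines with an oracle.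
--
-- A program is a sequence of instructions.  A configuration is a sequence
-- whose entry 0 is the program counter and whose entry r + 1 is the content
-- of register r.  The instructions are
--   ⟨ 0 , ⟨ r , j ⟩ ⟩   increment register r;
--   ⟨ 1 , ⟨ r , j ⟩ ⟩   if register r is 0 then jump to j, else decrement it;
--   ⟨ 2 , ⟨ r , j ⟩ ⟩   replace the content of register r by its value under
--                       the characteristic function of the oracle.
-- A machine halts when the program counter leaves the program.

-- Program e with oracle Y goes from configuration c to d.  The variables
-- are p, q (counters before and after), r, j, and v, w (contents of
-- register r before and after).
Step : Term n → Fin m → Term n → Term n → Formula n m
Step {n} {m} e Y c d = ∃ⁿ ∃ⁿ ∃ⁿ ∃ⁿ ∃ⁿ ∃ⁿ
    Entry c′ 𝟎 p ∧ Entry d′ 𝟎 q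
  ∧ Entry c′ (r ⊕ 𝟏) v ∧ Entry d′ (r ⊕ 𝟏) w
  ∧ (∀ⁿ ∀ⁿ ¬̇ x₁ ≐ 𝟎 ∧ ¬̇ x₁ ≐ r ↑ 2 ⊕ 𝟏 ⇒ (Entry (c′ ↑ 2) x₁ x₀ ⇔ Entry (d′ ↑ 2) x₁ x₀))
  ∧ ( Entry e′ p ⟨ 𝟎 , ⟨ r , j ⟩ ⟩ ∧ w ≐ v ⊕ 𝟏 ∧ q ≐ p ⊕ 𝟏
    ∨ Entry e′ p ⟨ 𝟏 , ⟨ r , j ⟩ ⟩ ∧ (v ≐ 𝟎 ∧ w ≐ 𝟎 ∧ q ≐ j ∨ v ≐ w ⊕ 𝟏 ∧ q ≐ p ⊕ 𝟏)
    ∨ Entry e′ p ⟨ 𝟏 ⊕ 𝟏 , ⟨ r , j ⟩ ⟩ ∧ (v ε Y ∧ w ≐ 𝟏 ∨ ¬̇ v ε Y ∧ w ≐ 𝟎) ∧ q ≐ p ⊕ 𝟏)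
  where
  e′ c′ d′ p q r j v w : Term (6 + n)
  e′ = e ↑ 6
  c′ = c ↑ 6
  d′ = d ↑ 6
  p  = x₅
  q  = x₄
  r  = x₃
  j  = x₂
  v  = x₁
  w  = x₀

-- Counter 0, input a in register 0, and 0 in the other registers.
Initial : Term n → Term n → Formula n m
Initial a c = Entry c 𝟎 𝟎 ∧ Entry c 𝟏 a
            ∧ (∀ⁿ ∀ⁿ Entry (c ↑ 2) (x₁ ⊕ 𝟏 ⊕ 𝟏) x₀ ⇒ x₀ ≐ 𝟎)

-- The output b is in register 0.
Final : Term n → Term n → Term n → Formula n m
Final e c b = (∃ⁿ Entry (c ↑ 1) 𝟎 x₀ ∧ ¬̇ (∃ⁿ Entry (e ↑ 2) x₁ x₀)) ∧ Entry c 𝟏 b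

-- Program e with oracle Y and input a halts with output b: there is a
-- sequence s = x₁ of configurations, the one with index l = x₀ being final.
Computes : Term n → Fin m → Term n → Term n → Formula n m
Computes e Y a b = ∃ⁿ ∃ⁿ
    (∃ⁿ Entry x₂ 𝟎 x₀ ∧ Initial (a ↑ 3) x₀)
  ∧ (∀ⁿ ∀ⁿ ∀ⁿ x₂ ≺ x₃ ∧ Entry x₄ x₂ x₁ ∧ Entry x₄ (x₂ ⊕ 𝟏) x₀ ⇒ Step (e ↑ 5) Y x₁ x₀)
  ∧ (∃ⁿ Entry x₂ x₁ x₀ ∧ Final (e ↑ 3) x₀ (b ↑ 3))

_≤T_ : Fin m → Fin m → Formula n m
X ≤T Y = ∃ⁿ ∀ⁿ (x₀ ε X ⇒ Computes x₁ Y x₀ 𝟏) ∧ (¬̇ x₀ ε X ⇒ Computes x₁ Y x₀ 𝟎)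

------------------------------------------------------------------------
-- Weak Martin's pointed tree theorem

-- [T] is cofinal.
Cofinal[_] : Fin m → Formula n m
Cofinal[ T ] = ∀ˢ ∃ˢ Path X₀ (suc (suc T)) ∧ X₁ ≤T X₀

wMPT : Sentence
wMPT = ∀ˢ Tree X₀ ∧ Cofinal[ X₀ ] ⇒ (∃ˢ Perfect X₀ ∧ X₀ ⊆̇ X₁)

------------------------------------------------------------------------
-- ATR₀

-- A set X of pairs is read as a reflexive relation ≤_X on its field.

_≤⟨_⟩_ _<⟨_⟩_ : Term n → Fin m → Term n → Formula n m
s ≤⟨ X ⟩ t = ⟨ s , t ⟩ ε X
s <⟨ X ⟩ t = s ≤⟨ X ⟩ t ∧ ¬̇ (t ≤⟨ X ⟩ s)

_∈field_ : Term n → Fin m → Formula n m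
t ∈field X = t ≤⟨ X ⟩ t

LinearOrder : Fin m → Formula n m
LinearOrder X =
    Relation X
  ∧ (∀ⁿ ∀ⁿ x₁ ≤⟨ X ⟩ x₀ ⇒ x₁ ∈field X ∧ x₀ ∈field X)
  ∧ (∀ⁿ ∀ⁿ ∀ⁿ x₂ ≤⟨ X ⟩ x₁ ∧ x₁ ≤⟨ X ⟩ x₀ ⇒ x₂ ≤⟨ X ⟩ x₀)
  ∧ (∀ⁿ ∀ⁿ x₁ ≤⟨ X ⟩ x₀ ∧ x₀ ≤⟨ X ⟩ x₁ ⇒ x₁ ≐ x₀)
  ∧ (∀ⁿ ∀ⁿ x₁ ∈field X ∧ x₀ ∈field X ⇒ x₁ ≤⟨ X ⟩ x₀ ∨ x₀ ≤⟨ X ⟩ x₁)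

-- No function is an infinite <_X-descending sequence.
WellFounded : Fin m → Formula n m
WellFounded X = ¬̇ (∃ˢ Function X₀
  ∧ (∀ⁿ ∀ⁿ ∀ⁿ ⟨ x₂ , x₁ ⟩ ε X₀ ∧ ⟨ x₂ ⊕ 𝟏 , x₀ ⟩ ε X₀ ⇒ x₀ <⟨ suc X ⟩ x₁))

WellOrder : Fin m → Formula n m
WellOrder X = LinearOrder X ∧ WellFounded X

-- Z = Y^j = { (a , i) ∈ Y : i <_X j }.
IsInitialPart : Fin m → Fin m → Fin m → Term n → Formula n m
IsInitialPart Z X Y j =
  ∀ⁿ x₀ ε Z ⇔ (∃ⁿ ∃ⁿ x₂ ≐ ⟨ x₁ , x₀ ⟩ ∧ x₀ <⟨ X ⟩ (j ↑ 3) ∧ x₂ ε Y)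

-- Y is the set of pairs (a , j) with j ∈ field(X) and θ(a , Y^j).  In θ,
-- number variable 0 is a, set variable 0 is Y^j, and the others are
-- parameters.
Hierarchy : Formula (suc n) (suc m) → Fin m → Fin m → Formula n m
Hierarchy θ X Y =
    Relation Y
  ∧ (∀ⁿ ∀ˢ IsInitialPart X₀ (suc X) (suc Y) x₀ ⇒
       (∀ⁿ ⟨ x₀ , x₁ ⟩ ε suc Y ⇔ x₁ ∈field suc X ∧ sub (liftᵗ (var ∘ suc)) id θ))

data ATR₀ : Theory where
  aca₀      : ∀ {φ} → φ ∈ ACA₀ → ATR₀ φ
  recursion : ∀ {n m} (θ : Formula (suc n) (suc m)) → Arithmetical θ →
              ATR₀ (∀* (∀ˢ WellOrder X₀ ⇒
                         (∃ˢ Hierarchy (sub var (lift 1 (2 ↑ʳ_)) θ) X₁ X₀)))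

{-# OPTIONS --safe #-}
module Submission where

-- Let G₀, G₁, … be mutually Cohen generic sets and let M consist of the sets
-- that are arithmetical in a suitable ground set B and finitely many Gᵢ.  Then
-- M is an ω-model of ACA₀.  If T ∈ M depends only on
-- G₀, …, Gₖ₋₁ and [T] is cofinal, then some condition r forces that a path Y
-- of T computes Gₖ.  The strings that extensions of r can force to be initial
-- segments of Y form a subtree of T in M.  It is perfect: deciding a bit of Gₖ
-- in two ways leads to different results of the same computation from Y,
-- hence to incompatible initial segments.  On the other hand, ATR₀ fails in M:
-- a recursion along ω yields a truth set for arithmetic over B, and forcing it
-- would make arithmetical truth arithmetical.
--
-- As the conclusion is negative, no generic sets are needed: forcing itself is
-- the (negative, hence classical) semantics, and provable sentences are forced.

open import Defs
open import Data.Bool.Base using (Bool; true; false; T) renaming (_∧_ to _&&_)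
open import Data.Bool.Properties using (T-∧) renaming (_≟_ to _≟ᵇ_)
open import Data.Empty using (⊥; ⊥-elim)
open import Data.Fin.Base using (Fin; zero; suc; lift; _↑ʳ_)
open import Data.List.Base using (List; []; _∷_)
open import Data.List.Membership.Propositional using () renaming (_∈_ to _∈ₗ_)
open import Data.List.Membership.Propositional.Properties using (∈-map⁻)
open import Data.List.Relation.Unary.Any using (here; there)
open import Data.Maybe.Base using (Maybe; just; nothing)
open import Data.Maybe.Properties using (≡-dec)
open import Data.Nat.Base using (ℕ; zero; suc; _+_; _*_; _∸_; _≤_; _<_; z≤n; s≤s; _!; NonZero; _⊔_)
open import Data.Nat.Coprimality using (Coprime; coprime-divisor; coprime-Bézout)
open import Data.Nat.Divisibility
  using (divides; ∣-trans; ∣-refl; m∣m*n; n∣m*n; ∣m+n∣m⇒∣n; ∣m⇒∣m*n; ∣⇒≤; ∣1⇒≡1; m≤n⇒m!∣n!)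
  renaming (_∣_ to _∣ℕ_)
open import Data.Nat.DivMod using (_/_; _%_; m≡m%n+[m/n]*n; m%n<n; [m+kn]%n≡m%n; m<n⇒m%n≡m)
open import Data.Nat.GCD using (module Bézout)
open import Data.Nat.Induction using (<-rec; <-wellFounded)
open import Data.Nat.Properties
open import Data.Nat.Tactic.RingSolver using (solve-∀)
open import Data.Product.Base using (∃; ∃₂; _×_; _,_; proj₁; proj₂)
open import Data.Sum.Base using (_⊎_; inj₁; inj₂)
open import Data.Unit.Base using (tt)
open import Data.Vec.Base using (Vec; []; _∷_; lookup)
open import Function.Base using (_∘_; id; case_of_)
open import Function.Bundles using (Equivalence)
open import Induction.WellFounded using (Acc; acc)
open import Relation.Binary.Definitions using (tri<; tri≈; tri>)
open import Relation.Binary.PropositionalEquality using (_≡_; _≢_; refl; sym; trans; cong; cong₂; subst; subst₂)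
open import Relation.Nullary using (¬_; yes; no; contradiction)
open import Relation.Nullary.Decidable using (decidable-stable)
open import Relation.Unary using (_∈_; _∪_; ｛_｝)

-- Two definability demands dictate the ground set. The subtree must have a name, so forcing must be
-- expressible by an `Expr` over `B`; and one step of the truth definition must be an arithmetical
-- formula with parameter `B`. Hence `B` is made to order: it tabulates the order of conditions,
-- their bits and the recursion clauses for truth on codes, and syntax never has to be arithmetized.
-- The generic sets enter through the product structure alone. What has support `k` sees only the
-- coordinates below `k` of a condition, and `merge` recombines these with the other coordinates of
-- a second condition. This makes the subtree definable from the first `k` generic sets, and it lets
-- two strings forced by conditions that disagree about a bit of Gₖ belong to the subtree below one
-- common condition. The two computations to be compared are forced by incompatible conditions, so
-- no single oracle carries both. Determinism is therefore proved for runs at two different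
-- conditions, under the hypothesis that these never contradict each other about small queries.

infix 1 _⟷_

_⟷_ : ∀ {a b} → Set a → Set b → Set _
A ⟷ B = (A → B) × (B → A)

-- Pairs and β-coded sequences

pair : ℕ → ℕ → ℕ
pair x y = (x + y) * (x + y) + x

pair-≥ˡ : ∀ x y → x ≤ pair x y
pair-≥ˡ x y = m≤n+m x _

m≤m*m : ∀ m → m ≤ m * m
m≤m*m zero = z≤n
m≤m*m (suc m) = m≤m*n (suc m) (suc m)

pair-≥ʳ : ∀ x y → y ≤ pair x y
pair-≥ʳ x y = ≤-trans (m≤n+m y x) (≤-trans (m≤m*m (x + y)) (m≤m+n _ x))

-- Adding `x ≤ x + y` to the square of `x + y` stays below the next square, so a pair determines the
-- sum of its components.
pair-sum-≤ : ∀ x y x′ y′ → pair x y ≡ pair x′ y′ → x′ + y′ ≤ x + y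
pair-sum-≤ x y x′ y′ eq = ≮⇒≥ λ lt → <-irrefl eq (begin-strict
  (x + y) * (x + y) + x              ≤⟨ +-monoʳ-≤ _ (m≤m+n x y) ⟩
  (x + y) * (x + y) + (x + y)        <⟨ square-gap (x + y) ⟩
  suc (x + y) * suc (x + y)          ≤⟨ *-mono-≤ lt lt ⟩
  (x′ + y′) * (x′ + y′)              ≤⟨ m≤m+n _ x′ ⟩
  (x′ + y′) * (x′ + y′) + x′         ∎)
  where
  open ≤-Reasoning
  square-gap : ∀ n → n * n + n < suc n * suc n
  square-gap n = subst (n * n + n <_) (sym (expand n)) (s≤s (m≤m+n _ n))
    where
    expand : ∀ n → suc n * suc n ≡ suc (n * n + n + n)
    expand = solve-∀

pair-injective : ∀ x y x′ y′ → pair x y ≡ pair x′ y′ → x ≡ x′ × y ≡ y′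
pair-injective x y x′ y′ eq = x≡x′ , +-cancelˡ-≡ x y y′ (trans sum (cong (_+ y′) (sym x≡x′)))
  where
  sum : x + y ≡ x′ + y′
  sum = ≤-antisym (pair-sum-≤ x′ y′ x y (sym eq)) (pair-sum-≤ x y x′ y′ eq)
  x≡x′ : x ≡ x′
  x≡x′ = +-cancelˡ-≡ ((x + y) * (x + y)) x x′ (trans eq (cong (λ s → s * s + x′) (sym sum)))

IsCode : ℕ → Set
IsCode s = ¬ ¬ ∃ λ l → ∃ λ a → ∃ λ d → s ≡ pair l (pair a d)

Entry′ : ℕ → ℕ → ℕ → Set
Entry′ s i v = ∃ λ l → ∃ λ a → ∃ λ d → ∃ λ w →
  s ≡ pair l (pair a d) × i < l × a ≡ w * (1 + d * (i + 1)) + v × v < 1 + d * (i + 1)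

infix 4 _[_]=_ _⊑ₛ_

-- The double negation is what forcing makes of the existential quantifiers in `Entry`, so the two
-- notions coincide at every condition.
_[_]=_ : ℕ → ℕ → ℕ → Set
s [ i ]= v = ¬ ¬ Entry′ s i v

remainder-unique : ∀ m {v v′} w w′ .{{_ : NonZero m}} → w * m + v ≡ w′ * m + v′ → v < m → v′ < m → v ≡ v′
remainder-unique m {v} {v′} w w′ eq v<m v′<m =
  trans (sym (rem w v<m)) (trans (cong (_% m) eq) (rem w′ v′<m))
  where
  rem : ∀ {v} w → v < m → (w * m + v) % m ≡ v
  rem {v} w v<m = trans (cong (_% m) (+-comm (w * m) v)) (trans ([m+kn]%n≡m%n v w m) (m<n⇒m%n≡m v<m))

entry-unique : ∀ {s i v v′} → s [ i ]= v → s [ i ]= v′ → v ≡ v′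
entry-unique {i = i} {v} {v′} h h′ = decidable-stable (v ≟ v′) λ k →
  h λ (l , a , d , w , s≡ , _ , a≡ , v<) →
  h′ λ (l′ , a′ , d′ , w′ , s≡′ , _ , a≡′ , v<′) →
  k (case pair-injective l (pair a d) l′ (pair a′ d′) (trans (sym s≡) s≡′) of λ where
       (refl , eq) → case pair-injective a d a′ d′ eq of λ where
         (refl , refl) → remainder-unique (1 + d * (i + 1)) w w′ (trans (sym a≡) a≡′) v< v<′)

entry-index< : ∀ {s i v} → s [ i ]= v → i < s
entry-index< {s} {i} h = decidable-stable (i <? s) λ k →
  h λ { (l , a , d , w , refl , i<l , _) → k (≤-trans i<l (pair-≥ˡ l _)) }

entry-value≤ : ∀ {s i v} → s [ i ]= v → v ≤ s
entry-value≤ {s} {v = v} h = decidable-stable (v ≤? s) λ k →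
  h λ { (l , a , d , w , refl , _ , refl , _) →
        k (≤-trans (m≤n+m v _) (≤-trans (pair-≥ˡ a d) (pair-≥ʳ l _))) }

entry-below : ∀ {s i j v} → s [ i ]= v → j ≤ i → ¬ ¬ ∃ λ v′ → s [ j ]= v′
entry-below {j = j} h j≤i k = h λ (l , a , d , w , s≡ , i<l , _) → let m = 1 + d * (j + 1) in
  k (a % m , λ k′ → k′
    (l , a , d , a / m , s≡ , ≤-<-trans j≤i i<l
    , trans (m≡m%n+[m/n]*n a m) (+-comm (a % m) (a / m * m)) , m%n<n a m))

_⊑ₛ_ : ℕ → ℕ → Set
s ⊑ₛ t = ∀ i v → s [ i ]= v → t [ i ]= v

IsString : ℕ → Set
IsString s = IsCode s × (∀ x → x < s × IsCode x → ¬ (x ⊑ₛ s × s ⊑ₛ x))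

-- Existence of sequences: the Chinese remainder theorem

coprime-* : ∀ {a b c} → Coprime a c → Coprime b c → Coprime (a * b) c
coprime-* {a} {b} a⊥c b⊥c {d} (d∣ab , d∣c) =
  b⊥c (coprime-divisor (λ (e∣d , e∣a) → a⊥c (e∣a , ∣-trans e∣d d∣c)) d∣ab , d∣c)

_≡_mod_ : ℕ → ℕ → ℕ → Set
a ≡ v mod m = ∃₂ λ w w′ → a + w * m ≡ v + w′ * m

-- Modulo `suc k` the number `k` is -1, so `a * k` and `v * k` act as -a and -v, and either sign of
-- Bézout's identity yields `t` without subtraction.
solve-mod : ∀ {P k} → Coprime P (suc k) → ∀ a v → ∃ λ t → (a + t * P) ≡ v mod suc k
solve-mod {P} {k} P⊥m a v with coprime-Bézout P⊥m
... | Bézout.+- x y eq = (v + a * k) * x , 0 , a + (v + a * k) * y ,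
  trans (shape a (v + a * k) x P (suc k)) (trans (cong (λ z → a + (v + a * k) * z) (sym eq)) (combine a v k y))
  where
  shape : ∀ a c x P m → a + c * x * P + 0 * m ≡ a + c * (x * P)
  shape = solve-∀
  combine : ∀ a v k y → a + (v + a * k) * (1 + y * suc k) ≡ v + (a + (v + a * k) * y) * suc k
  combine = solve-∀
... | Bézout.-+ x y eq = (a + v * k) * x , v , (a + v * k) * y ,
  trans (shape a v k x P) (trans (cong (λ z → v + (a + v * k) * z) eq) (assoc v (a + v * k) y (suc k)))
  where
  shape : ∀ a v k x P → a + (a + v * k) * x * P + v * suc k ≡ v + (a + v * k) * (1 + x * P)
  shape = solve-∀
  assoc : ∀ v c y m → v + c * (y * m) ≡ v + c * y * m
  assoc = solve-∀

∏ : ℕ → (ℕ → ℕ) → ℕ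
∏ zero m = 1
∏ (suc n) m = ∏ n m * m n

∣∏ : ∀ {i n} m → i < n → m i ∣ℕ ∏ n m
∣∏ {i} {suc n} m i<1+n with m≤n⇒m<n∨m≡n i<1+n
... | inj₁ (s≤s i<n) = ∣m⇒∣m*n (m n) (∣∏ m i<n)
... | inj₂ refl = n∣m*n (∏ n m)

chinese-remainder : (m f : ℕ → ℕ) → ∀ n → (∀ {i j} → i < j → j < n → Coprime (suc (m i)) (suc (m j))) →
                    ∃ λ a → ∀ i → i < n → a ≡ f i mod suc (m i)
chinese-remainder m f zero _ = 0 , λ _ ()
chinese-remainder m f (suc n) ⊥m with chinese-remainder m f n (λ i<j j<n → ⊥m i<j (m<n⇒m<1+n j<n))
... | a , a≡ with solve-mod {∏ n (suc ∘ m)} {m n} (∏⊥ n ≤-refl) a (f n)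
  where
  ∏⊥ : ∀ k → k ≤ n → Coprime (∏ k (suc ∘ m)) (suc (m n))
  ∏⊥ zero _ (d∣1 , _) = ∣1⇒≡1 d∣1
  ∏⊥ (suc k) k<n = coprime-* (∏⊥ k (<⇒≤ k<n)) (⊥m k<n ≤-refl)
... | t , eqₙ = a + t * ∏ n (suc ∘ m) , go
  where
  go : ∀ i → i < suc n → (a + t * ∏ n (suc ∘ m)) ≡ f i mod suc (m i)
  go i i<1+n with m≤n⇒m<n∨m≡n i<1+n
  ... | inj₂ refl = eqₙ
  ... | inj₁ (s≤s i<n) with a≡ i i<n | ∣∏ (suc ∘ m) i<n
  ...   | w , w′ , eq | divides q ∏≡ = w , w′ + t * q ,
    trans (cong (λ z → a + t * z + w * suc (m i)) ∏≡)
      (trans (swap a t q w (suc (m i))) (trans (cong (_+ t * q * suc (m i)) eq)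
        (merge (f i) w′ (t * q) (suc (m i)))))
    where
    swap : ∀ a t q w m → a + t * (q * m) + w * m ≡ a + w * m + t * q * m
    swap = solve-∀
    merge : ∀ v w′ c m → v + w′ * m + c * m ≡ v + (w′ + c) * m
    merge = solve-∀

-- A common divisor is coprime to `d`, since it divides `1 + d * (i + 1)`. It divides the difference
-- `d * (j ∸ i)`, hence `j ∸ i`, hence `d`, and so it is 1.
β-coprime : ∀ {d i j} → i < j → (j ∸ i) ∣ℕ d → Coprime (1 + d * (i + 1)) (1 + d * (j + 1))
β-coprime {d} {i} {j} i<j j∸i∣d {g} (g∣mᵢ , g∣mⱼ) = g⊥d (∣-refl , ∣-trans (coprime-divisor g⊥d g∣d*) j∸i∣d)
  where
  g⊥d : Coprime g d
  g⊥d {e} (e∣g , e∣d) = ∣1⇒≡1 (∣m+n∣m⇒∣n {m = d * (i + 1)} {n = 1}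
    (subst (e ∣ℕ_) (+-comm 1 (d * (i + 1))) (∣-trans e∣g g∣mᵢ)) (∣m⇒∣m*n (i + 1) e∣d))
  split : ∀ d i k → 1 + d * (i + k + 1) ≡ (1 + d * (i + 1)) + d * k
  split = solve-∀
  g∣d* : g ∣ℕ d * (j ∸ i)
  g∣d* = ∣m+n∣m⇒∣n
    (subst (g ∣ℕ_)
      (trans (cong (λ z → 1 + d * (z + 1)) (sym (m+[n∸m]≡n (<⇒≤ i<j)))) (split d i (j ∸ i))) g∣mⱼ) g∣mᵢ

∣! : ∀ {k n} → 0 < k → k ≤ n → k ∣ℕ n !
∣! {suc k} _ k≤n = ∣-trans (m∣m*n (k !)) (m≤n⇒m!∣n! k≤n)

n≤n! : ∀ n → n ≤ n !
n≤n! zero = z≤n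
n≤n! (suc n) = ∣⇒≤ {{m*n≢0 (suc n) (n !) {{_}} {{n !≢0}}}} (m∣m*n (n !))

bounded : (f : ℕ → ℕ) → ∀ n → ∃ λ b → ∀ i → i < n → f i ≤ b
bounded f zero = 0 , λ _ ()
bounded f (suc n) with bounded f n
... | b , f≤b = b ⊔ f n , go
  where
  go : ∀ i → i < suc n → f i ≤ b ⊔ f n
  go i i<1+n with m≤n⇒m<n∨m≡n i<1+n
  ... | inj₁ (s≤s i<n) = ≤-trans (f≤b i i<n) (m≤m⊔n b (f n))
  ... | inj₂ refl = m≤n⊔m b (f n)

Lists : ℕ → ℕ → (ℕ → ℕ) → Set
Lists s l f = ∀ i v → s [ i ]= v ⟷ i < l × v ≡ f i

code-exists : (f : ℕ → ℕ) (l : ℕ) → ∃ λ s → IsCode s × Lists s l f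
code-exists f l with bounded f l
... | b , f≤b with chinese-remainder (λ i → (l + b) ! * (i + 1)) f l
  (λ {i} {j} i<j j<l → β-coprime {(l + b) !} i<j
    (∣! (m<n⇒0<n∸m i<j) (≤-trans (m∸n≤m j i) (≤-trans (<⇒≤ j<l) (m≤m+n l b)))))
... | a , a≡ = pair l (pair a d) , (λ k → k (l , a , d , refl)) , λ i v →
    (λ h → let i<l = index< h in i<l , entry-unique h (entry i i<l))
  , λ { (i<l , refl) → entry i i<l }
  where
  -- The factorial is divisible by every difference of indices below `l`, which makes the moduli
  -- coprime, and is at least `b`, which keeps every entry below its modulus.
  d = (l + b) !
  index< : ∀ {i v} → pair l (pair a d) [ i ]= v → i < l
  index< {i} h = decidable-stable (i <? l) λ k → h λ (l′ , a′ , d′ , w , s≡ , i<l , _) →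
    k (subst (i <_) (sym (proj₁ (pair-injective l (pair a d) l′ (pair a′ d′) s≡))) i<l)
  entry : ∀ i → i < l → pair l (pair a d) [ i ]= f i
  entry i i<l k with a≡ i i<l
  ... | w , w′ , eq = k (l , a , d , a / m , refl , i<l
      , trans (m≡m%n+[m/n]*n a m) (trans (cong (_+ a / m * m) a%m) (+-comm (f i) _)) , fi<m)
    where
    m = 1 + d * (i + 1)
    fi<m : f i < m
    fi<m = s≤s (≤-trans (f≤b i i<l) (≤-trans (m≤n+m b l) (≤-trans (n≤n! (l + b))
             (m≤m*n d (i + 1) {{subst NonZero (+-comm 1 i) _}}))))
    a%m : a % m ≡ f i
    a%m = trans (sym ([m+kn]%n≡m%n a w m)) (trans (cong (_% m) eq)
      (trans ([m+kn]%n≡m%n (f i) w′ m) (m<n⇒m%n≡m fi<m)))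

Represented : (ℕ → ℕ) → ℕ → Set
Represented f l = ¬ ¬ ∃ λ s → IsString s × Lists s l f

-- Any smaller code of the same sequence also lists `f`, so the recursion descends to the least one;
-- whether a smaller one exists is undecided, whence the double negation.
least-code : ∀ {f l} s → IsCode s → Lists s l f → Represented f l
least-code {f} {l} = <-rec (λ s → IsCode s → Lists s l f → Represented f l) λ s rec code lists k →
  k (s , (code , λ x (x<s , xcode) (x⊑s , s⊑x) →
    rec x<s xcode (λ i v → (λ h → proj₁ (lists i v) (x⊑s i v h)) , (λ h → s⊑x i v (proj₂ (lists i v) h))) k)
  , lists)

string-exists : ∀ f l → Represented f l
string-exists f l k = let s , code , lists = code-exists f l in least-code s code lists k

private
  variable
    n m n′ m′ : ℕ

-- Cohen conditions: finitely many bits of the generic sets G₀, G₁, …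
-- In a list the first bit given for a place counts.

Cond : Set
Cond = List (ℕ × ℕ × Bool)

private
  variable
    p q r : Cond

look : Cond → ℕ → ℕ → Maybe Bool
look [] i x = nothing
look ((j , y , b) ∷ p) i x with i ≟ j | x ≟ y
... | yes _ | yes _ = just b
... | yes _ | no _  = look p i x
... | no _  | _     = look p i x

infix 4 _≼_ _≼[_]_ _≈[_]_

record _≼_ (q p : Cond) : Set where
  constructor ≼-by
  field keep : ∀ i x {b} → look p i x ≡ just b → look q i x ≡ just b

record _≼[_]_ (q : Cond) (k : ℕ) (p : Cond) : Set where
  constructor ≼[]-by
  field keep : ∀ i x {b} → i < k → look p i x ≡ just b → look q i x ≡ just b

record _≈[_]_ (q : Cond) (k : ℕ) (p : Cond) : Set where
  constructor ≈-by
  field agree : ∀ i x → i < k → look q i x ≡ look p i x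

open _≈[_]_

≼-refl : p ≼ p
≼-refl = ≼-by λ _ _ eq → eq

≼-trans : r ≼ q → q ≼ p → r ≼ p
≼-trans (≼-by r≼q) (≼-by q≼p) = ≼-by λ i x eq → r≼q i x (q≼p i x eq)

≼⇒≼[] : ∀ {k} → q ≼ p → q ≼[ k ] p
≼⇒≼[] (≼-by q≼p) = ≼[]-by λ i x _ → q≼p i x

≈⇒≼[] : ∀ {k} → q ≈[ k ] p → q ≼[ k ] p
≈⇒≼[] (≈-by q≈p) = ≼[]-by λ i x i<k eq → trans (q≈p i x i<k) eq

≼[]-trans : ∀ {k} → r ≼[ k ] q → q ≼[ k ] p → r ≼[ k ] p
≼[]-trans (≼[]-by r≼q) (≼[]-by q≼p) = ≼[]-by λ i x i<k eq → r≼q i x i<k (q≼p i x i<k eq)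

≈-sym : ∀ {k} → q ≈[ k ] p → p ≈[ k ] q
≈-sym (≈-by q≈p) = ≈-by λ i x i<k → sym (q≈p i x i<k)

≈-≤ : ∀ {j k} → j ≤ k → q ≈[ k ] p → q ≈[ j ] p
≈-≤ j≤k (≈-by q≈p) = ≈-by λ i x i<j → q≈p i x (≤-trans i<j j≤k)

above : ℕ → Cond → Cond
above k [] = []
above k ((j , y , b) ∷ p) with j <? k
... | yes _ = above k p
... | no _  = (j , y , b) ∷ above k p

-- The condition given by `q` on the generic sets below `k` and by `p` on the others.
merge : ℕ → Cond → Cond → Cond
merge k [] p = above k p
merge k ((j , y , b) ∷ q) p with j <? k
... | yes _ = (j , y , b) ∷ merge k q p
... | no _  = merge k q p

look-∷ : ∀ j y b p q {i x} → look p i x ≡ look q i x → look ((j , y , b) ∷ p) i x ≡ look ((j , y , b) ∷ q) i x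
look-∷ j y b p q {i} {x} eq with i ≟ j | x ≟ y
... | yes _ | yes _ = refl
... | yes _ | no _  = eq
... | no _  | _     = eq

look-skip : ∀ {i j} y b p {x} → i ≢ j → look ((j , y , b) ∷ p) i x ≡ look p i x
look-skip {i} {j} y b p {x} i≢j with i ≟ j | x ≟ y
... | yes i≡j | _ = contradiction i≡j i≢j
... | no _ | _ = refl

look-above-< : ∀ {k} p {i x} → i < k → look (above k p) i x ≡ nothing
look-above-< [] i<k = refl
look-above-< {k} ((j , y , b) ∷ p) i<k with j <? k
... | yes _ = look-above-< p i<k
... | no j≮k = trans (look-skip y b (above k p) λ { refl → j≮k i<k }) (look-above-< p i<k)

look-above-≥ : ∀ {k} p {i x} → k ≤ i → look (above k p) i x ≡ look p i x
look-above-≥ [] k≤i = refl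
look-above-≥ {k} ((j , y , b) ∷ p) k≤i with j <? k
... | yes j<k = trans (look-above-≥ p k≤i) (sym (look-skip y b p λ { refl → <⇒≱ j<k k≤i }))
... | no _ = look-∷ j y b (above _ p) p (look-above-≥ p k≤i)

look-merge-< : ∀ {k} q {p i x} → i < k → look (merge k q p) i x ≡ look q i x
look-merge-< [] {p} i<k = look-above-< p i<k
look-merge-< {k} ((j , y , b) ∷ q) {p} i<k with j <? k
... | yes _ = look-∷ j y b (merge k q p) q (look-merge-< q i<k)
... | no j≮k = trans (look-merge-< q i<k) (sym (look-skip y b q λ { refl → j≮k i<k }))

look-merge-≥ : ∀ {k} q {p i x} → k ≤ i → look (merge k q p) i x ≡ look p i x
look-merge-≥ [] {p} k≤i = look-above-≥ p k≤i
look-merge-≥ {k} ((j , y , b) ∷ q) {p} k≤i with j <? k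
... | yes j<k = trans (look-skip y b (merge k q p) λ { refl → <⇒≱ j<k k≤i }) (look-merge-≥ q k≤i)
... | no _ = look-merge-≥ q k≤i

merge-≼ : ∀ {k} → q ≼[ k ] p → merge k q p ≼ p
merge-≼ {q} {p} {k} (≼[]-by q≼p) = ≼-by go
  where
  go : ∀ i x {b} → look p i x ≡ just b → look (merge k q p) i x ≡ just b
  go i x eq with i <? k
  ... | yes i<k = trans (look-merge-< q i<k) (q≼p i x i<k eq)
  ... | no i≮k = trans (look-merge-≥ q (≮⇒≥ i≮k)) eq

merge-≈ : ∀ k q p → merge k q p ≈[ k ] q
merge-≈ k q p = ≈-by λ i x → look-merge-< q

top : Cond → ℕ
top [] = 0
top ((_ , y , _) ∷ p) = suc y ⊔ top p

look-top : ∀ p {i x} → top p ≤ x → look p i x ≡ nothing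
look-top [] le = refl
look-top ((j , y , b) ∷ p) {i} {x} le with i ≟ j | x ≟ y
... | yes _ | yes refl = contradiction (≤-trans (m≤m⊔n (suc y) (top p)) le) 1+n≰n
... | yes _ | no _  = look-top p (≤-trans (m≤n⊔m (suc y) (top p)) le)
... | no _  | _     = look-top p (≤-trans (m≤n⊔m (suc y) (top p)) le)

decide-≼ : ∀ k x b p → look p k x ≡ nothing → (k , x , b) ∷ p ≼ p
decide-≼ k x b p undecided = ≼-by go
  where
  go : ∀ i y {c} → look p i y ≡ just c → look ((k , x , b) ∷ p) i y ≡ just c
  go i y eq with i ≟ k | y ≟ x
  ... | yes refl | yes refl = case trans (sym eq) undecided of λ ()
  ... | yes _ | no _  = eq
  ... | no _  | _     = eq

decide-look : ∀ k x b p → look ((k , x , b) ∷ p) k x ≡ just b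
decide-look k x b p with k ≟ k | x ≟ x
... | yes _ | yes _ = refl
... | no k≢k | _ = contradiction refl k≢k
... | yes _ | no x≢x = contradiction refl x≢x

decide-≼[] : ∀ k x b p → p ≼[ k ] (k , x , b) ∷ p
decide-≼[] k x b p = ≼[]-by λ i y i<k eq → trans (sym (look-skip x b p (<⇒≢ i<k))) eq

-- Expressions for the sets that are arithmetical in B, and their codes

encList : ∀ {A : Set} → (A → ℕ) → List A → ℕ
encList f [] = 0
encList f (x ∷ xs) = suc (pair (f x) (encList f xs))

encList-injective : ∀ {A : Set} {f : A → ℕ} → (∀ {x y} → f x ≡ f y → x ≡ y) →
                    ∀ xs ys → encList f xs ≡ encList f ys → xs ≡ ys
encList-injective f-inj [] [] eq = refl
encList-injective {f = f} f-inj (x ∷ xs) (y ∷ ys) eq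
  with pair-injective (f x) (encList f xs) (f y) (encList f ys) (suc-injective eq)
... | eq₁ , eq₂ = cong₂ _∷_ (f-inj eq₁) (encList-injective f-inj xs ys eq₂)

bit : Bool → ℕ
bit false = 0
bit true = 1

encBit : ℕ × ℕ × Bool → ℕ
encBit (i , x , b) = pair i (pair x (bit b))

encBit-injective : ∀ {s t} → encBit s ≡ encBit t → s ≡ t
encBit-injective {i , x , b} {j , y , c} eq
  with pair-injective i (pair x (bit b)) j (pair y (bit c)) eq
... | refl , eq′ with pair-injective x (bit b) y (bit c) eq′
... | refl , eq″ = cong (λ b → i , x , b) (bit-injective b c eq″)
  where
  bit-injective : ∀ b c → bit b ≡ bit c → b ≡ c
  bit-injective false false eq = refl
  bit-injective true true eq = refl

enc : Cond → ℕ
enc = encList encBit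

enc-injective : ∀ p q → enc p ≡ enc q → p ≡ q
enc-injective = encList-injective encBit-injective

#_ : List ℕ → ℕ
#_ = encList id

#-injective : ∀ ρ ρ′ → # ρ ≡ # ρ′ → ρ ≡ ρ′
#-injective = encList-injective id

data Tm : Set where
  ref lit   : ℕ → Tm
  _+ᵗ_ _*ᵗ_ : Tm → Tm → Tm

infixl 8 _+ᵗ_
infixl 9 _*ᵗ_

at : List ℕ → ℕ → ℕ
at [] _ = 0
at (x ∷ _) zero = x
at (_ ∷ ρ) (suc i) = at ρ i

evalᵗ : Tm → List ℕ → ℕ
evalᵗ (ref i) ρ = at ρ i
evalᵗ (lit c) ρ = c
evalᵗ (s +ᵗ t) ρ = evalᵗ s ρ + evalᵗ t ρ
evalᵗ (s *ᵗ t) ρ = evalᵗ s ρ * evalᵗ t ρ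

shift : Tm → Tm
shift (ref i) = ref (suc i)
shift (lit c) = lit c
shift (s +ᵗ t) = shift s +ᵗ shift t
shift (s *ᵗ t) = shift s *ᵗ shift t

evalᵗ-shift : ∀ t {x ρ} → evalᵗ (shift t) (x ∷ ρ) ≡ evalᵗ t ρ
evalᵗ-shift (ref i) = refl
evalᵗ-shift (lit c) = refl
evalᵗ-shift (s +ᵗ t) = cong₂ _+_ (evalᵗ-shift s) (evalᵗ-shift t)
evalᵗ-shift (s *ᵗ t) = cong₂ _*_ (evalᵗ-shift s) (evalᵗ-shift t)

pairᵗ : Tm → Tm → Tm
pairᵗ s t = (s +ᵗ t) *ᵗ (s +ᵗ t) +ᵗ s

encTm : Tm → ℕ
encTm (ref i) = pair 0 i
encTm (lit c) = pair 1 c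
encTm (s +ᵗ t) = pair 2 (pair (encTm s) (encTm t))
encTm (s *ᵗ t) = pair 3 (pair (encTm s) (encTm t))

data Expr : Set where
  mem : Tm → Expr
  _⊃_ : Expr → Expr → Expr
  all : Expr → Expr

infixr 5 _⊃_

-- The successor makes the code of a subexpression strictly smaller, so that the truth recursion can
-- run along the usual order of ω.
encExpr : Expr → ℕ
encExpr (mem t) = suc (pair 0 (encTm t))
encExpr (c ⊃ d) = suc (pair 1 (pair (encExpr c) (encExpr d)))
encExpr (all c) = suc (pair 2 (encExpr c))

⊃-<ˡ : ∀ c d → encExpr c < encExpr (c ⊃ d)
⊃-<ˡ c d = s≤s (≤-trans (pair-≥ˡ (encExpr c) (encExpr d)) (pair-≥ʳ 1 _))

⊃-<ʳ : ∀ c d → encExpr d < encExpr (c ⊃ d)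
⊃-<ʳ c d = s≤s (≤-trans (pair-≥ʳ (encExpr c) (encExpr d)) (pair-≥ʳ 1 _))

all-< : ∀ c → encExpr c < encExpr (all c)
all-< c = s≤s (pair-≥ʳ 2 (encExpr c))

encTm-injective : ∀ s t → encTm s ≡ encTm t → s ≡ t
encTm-injective s t eq = go s t (split s t eq)
  where
  tag body : Tm → ℕ
  tag (ref _) = 0
  tag (lit _) = 1
  tag (_ +ᵗ _) = 2
  tag (_ *ᵗ _) = 3
  body (ref i) = i
  body (lit c) = c
  body (s +ᵗ t) = pair (encTm s) (encTm t)
  body (s *ᵗ t) = pair (encTm s) (encTm t)
  shape : ∀ t → encTm t ≡ pair (tag t) (body t)
  shape (ref _) = refl
  shape (lit _) = refl
  shape (_ +ᵗ _) = refl
  shape (_ *ᵗ _) = refl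
  split : ∀ s t → encTm s ≡ encTm t → tag s ≡ tag t × body s ≡ body t
  split s t eq = pair-injective (tag s) (body s) (tag t) (body t) (trans (sym (shape s)) (trans eq (shape t)))
  go : ∀ s t → tag s ≡ tag t × body s ≡ body t → s ≡ t
  go (ref _) (ref _) (_ , eq) = cong ref eq
  go (lit _) (lit _) (_ , eq) = cong lit eq
  go (s +ᵗ t) (s′ +ᵗ t′) (_ , eq) with pair-injective (encTm s) (encTm t) (encTm s′) (encTm t′) eq
  ... | e₁ , e₂ = cong₂ _+ᵗ_ (go s s′ (split s s′ e₁)) (go t t′ (split t t′ e₂))
  go (s *ᵗ t) (s′ *ᵗ t′) (_ , eq) with pair-injective (encTm s) (encTm t) (encTm s′) (encTm t′) eq
  ... | e₁ , e₂ = cong₂ _*ᵗ_ (go s s′ (split s s′ e₁)) (go t t′ (split t t′ e₂))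

encExpr-injective : ∀ c d → encExpr c ≡ encExpr d → c ≡ d
encExpr-injective c d eq = go c d (split c d eq)
  where
  tag body : Expr → ℕ
  tag (mem _) = 0
  tag (_ ⊃ _) = 1
  tag (all _) = 2
  body (mem t) = encTm t
  body (c ⊃ d) = pair (encExpr c) (encExpr d)
  body (all c) = encExpr c
  shape : ∀ c → encExpr c ≡ suc (pair (tag c) (body c))
  shape (mem _) = refl
  shape (_ ⊃ _) = refl
  shape (all _) = refl
  split : ∀ c d → encExpr c ≡ encExpr d → tag c ≡ tag d × body c ≡ body d
  split c d eq = pair-injective (tag c) (body c) (tag d) (body d)
    (suc-injective (trans (sym (shape c)) (trans eq (shape d))))
  go : ∀ c d → tag c ≡ tag d × body c ≡ body d → c ≡ d
  go (mem s) (mem t) (_ , eq) = cong mem (encTm-injective s t eq)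
  go (c ⊃ d) (c′ ⊃ d′) (_ , eq) with pair-injective (encExpr c) (encExpr d) (encExpr c′) (encExpr d′) eq
  ... | e₁ , e₂ = cong₂ _⊃_ (go c c′ (split c c′ e₁)) (go d d′ (split d d′ e₂))
  go (all c) (all d) (_ , eq) = cong all (go c d (split c d eq))

-- Truth of the code c at the sequence ρ is the membership of key c ρ in the
-- row encExpr c of a truth set.

key row : Expr → List ℕ → ℕ
key c ρ = pair (encExpr c) (# ρ)
row c ρ = pair (key c ρ) (encExpr c)

-- The tables of the ground set B.  The first three spell out the
-- recursion of truth on codes; the others serve to define forcing.

data Table : ℕ → ℕ → Set where
  value   : ∀ {z} t ρ → z ≡ pair (key (mem t) ρ) (evalᵗ t ρ) → Table 0 z
  implies : ∀ {z} c d ρ → z ≡ pair (key (c ⊃ d) ρ) (pair (row c ρ) (row d ρ)) → Table 1 z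
  forall′ : ∀ {z} c x ρ → z ≡ pair (key (all c) ρ) (row c (x ∷ ρ)) → Table 2 z
  equal   : ∀ {z} x y → z ≡ pair x y → x ≡ y → Table 3 z
  less    : ∀ {z} x y → z ≡ pair x y → x < y → Table 4 z
  leq     : ∀ {z} x y → z ≡ pair x y → x ≤ y → Table 5 z
  extends : ∀ {z} q p → z ≡ pair (enc q) (enc p) → q ≼ p → Table 6 z
  extendsₖ : ∀ {z} k q p → z ≡ pair k (pair (enc q) (enc p)) → q ≼[ k ] p → Table 7 z
  bit-on  : ∀ {z} p i x → z ≡ pair (enc p) (pair i x) → look p i x ≡ just true → Table 8 z

B : ℕ → Set
B y = ∃₂ λ t z → y ≡ pair t z × Table t z

B→Table : ∀ t z → B (pair t z) → Table t z
B→Table t z (t′ , z′ , eq , h) with pair-injective t z t′ z′ eq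
... | refl , refl = h

Table→B : ∀ {t z} → Table t z → B (pair t z)
Table→B {t} {z} h = t , z , refl , h

-- Truth over `B` in a negative language with doubly negated atoms, hence stable under double
-- negation.
Sem : Expr → List ℕ → Set
Sem (mem t) ρ = ¬ ¬ B (evalᵗ t ρ)
Sem (c ⊃ d) ρ = Sem c ρ → Sem d ρ
Sem (all c) ρ = ∀ x → Sem c (x ∷ ρ)

Sem-stable : ∀ c {ρ} → ¬ ¬ Sem c ρ → Sem c ρ
Sem-stable (mem t) h k = h (λ h′ → h′ k)
Sem-stable (c ⊃ d) h x = Sem-stable d λ k → h λ f → k (f x)
Sem-stable (all c) h x = Sem-stable c λ k → h λ f → k (f x)

tableᶜ : ℕ → Tm → Expr
tableᶜ i t = mem (pairᵗ (lit i) t)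

-- There is no table 9, so this atom is false.
⊥ᶜ : Expr
⊥ᶜ = tableᶜ 9 (lit 0)

⊥ᶜ-elim : ∀ {ρ} → ¬ Sem ⊥ᶜ ρ
⊥ᶜ-elim h = h λ b → case B→Table 9 0 b of λ ()

_∧ᶜ_ : Expr → Expr → Expr
c ∧ᶜ d = (c ⊃ d ⊃ ⊥ᶜ) ⊃ ⊥ᶜ

∧ᶜ-correct : ∀ c d {ρ} → Sem (c ∧ᶜ d) ρ ⟷ Sem c ρ × Sem d ρ
∧ᶜ-correct c d {ρ} =
    (λ h → Sem-stable c (λ k → ⊥ᶜ-elim {ρ} (h λ x _ → ⊥-elim (k x)))
         , Sem-stable d (λ k → ⊥ᶜ-elim {ρ} (h λ _ y → ⊥-elim (k y))))
  , λ (x , y) f → f x y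

eqᶜ : Tm → Tm → Expr
eqᶜ s t = tableᶜ 3 (pairᵗ s t)

eqᶜ-correct : ∀ s t {ρ} → Sem (eqᶜ s t) ρ ⟷ evalᵗ s ρ ≡ evalᵗ t ρ
eqᶜ-correct s t {ρ} =
    (λ h → decidable-stable (u ≟ v) λ k → h λ b → case B→Table 3 (pair u v) b of λ where
      (equal x y eq x≡y) → case pair-injective u v x y eq of λ { (refl , refl) → k x≡y })
  , λ eq k → k (Table→B (equal u v refl eq))
  where
  u = evalᵗ s ρ
  v = evalᵗ t ρ

ltᶜ-correct : ∀ s t {ρ} → Sem (tableᶜ 4 (pairᵗ s t)) ρ ⟷ evalᵗ s ρ < evalᵗ t ρ
ltᶜ-correct s t {ρ} =
    (λ h → decidable-stable (u <? v) λ k → h λ b → case B→Table 4 (pair u v) b of λ where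
      (less x y eq x<y) → case pair-injective u v x y eq of λ { (refl , refl) → k x<y })
  , λ lt k → k (Table→B (less u v refl lt))
  where
  u = evalᵗ s ρ
  v = evalᵗ t ρ

-- Names and forcing

infix 1 _⊪_

-- `Regular` is closure under forced double negation: what holds densely below a condition holds at
-- it.
Mono Regular : (Cond → Set) → Set
Mono F = ∀ {p q} → q ≼ p → F p → F q
Regular F = ∀ {p} → (∀ {q} → q ≼ p → (∀ {r} → r ≼ q → F r → ⊥) → ⊥) → F p

Local : ℕ → (Cond → Set) → Set
Local k F = ∀ {p q} → p ≈[ k ] q → F p → F q

-- A name is a definable forcing relation p ⊩ x ∈ N.  The support k says that N
-- depends only on G₀, …, Gₖ₋₁.
record Name : Set where
  field
    expr    : Expr
    tail    : ∀ p x {ρ ρ′} → Sem expr (enc p ∷ x ∷ ρ) → Sem expr (enc p ∷ x ∷ ρ′)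
    support : ℕ

  Has : ℕ → Cond → Set
  Has x p = Sem expr (enc p ∷ x ∷ [])

  field
    mono    : ∀ {x} → Mono (Has x)
    regular : ∀ {x} → Regular (Has x)
    local   : ∀ {x} → Local support (Has x)

open Name public using (Has)

⟦_⟧ : Term n → Vec ℕ n → ℕ
⟦ var i ⟧ e = lookup e i
⟦ 𝟎 ⟧ e = 0
⟦ 𝟏 ⟧ e = 1
⟦ s ⊕ t ⟧ e = ⟦ s ⟧ e + ⟦ t ⟧ e
⟦ s ⊗ t ⟧ e = ⟦ s ⟧ e * ⟦ t ⟧ e

-- Disjunction and existence are abbreviations through negation, so these clauses define weak
-- forcing; set quantifiers range over names.
Force : Formula n m → Vec ℕ n → Vec Name m → Cond → Set
Force (s ≐ t) e ν p = ⟦ s ⟧ e ≡ ⟦ t ⟧ e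
Force (s ≺ t) e ν p = ⟦ s ⟧ e < ⟦ t ⟧ e
Force (t ε X) e ν p = Has (lookup ν X) (⟦ t ⟧ e) p
Force ⊥̇       e ν p = ⊥
Force (φ ⇒ ψ) e ν p = ∀ {q} → q ≼ p → Force φ e ν q → Force ψ e ν q
Force (φ ∧ ψ) e ν p = Force φ e ν p × Force ψ e ν p
Force (∀ⁿ φ)  e ν p = ∀ x → Force φ (x ∷ e) ν p
Force (∀ˢ φ)  e ν p = ∀ N → Force φ e (N ∷ ν) p

Force-mono : (φ : Formula n m) {e : Vec ℕ n} {ν : Vec Name m} → Mono (Force φ e ν)
Force-mono (s ≐ t) q≼p h = h
Force-mono (s ≺ t) q≼p h = h
Force-mono (t ε X) {ν = ν} q≼p h = Name.mono (lookup ν X) q≼p h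
Force-mono ⊥̇ q≼p h = h
Force-mono (φ ⇒ ψ) q≼p h r≼q = h (≼-trans r≼q q≼p)
Force-mono (φ ∧ ψ) q≼p (h , k) = Force-mono φ q≼p h , Force-mono ψ q≼p k
Force-mono (∀ⁿ φ) q≼p h x = Force-mono φ q≼p (h x)
Force-mono (∀ˢ φ) q≼p h N = Force-mono φ q≼p (h N)

Force-regular : (φ : Formula n m) {e : Vec ℕ n} {ν : Vec Name m} → Regular (Force φ e ν)
Force-regular (s ≐ t) {e} h = decidable-stable (⟦ s ⟧ e ≟ ⟦ t ⟧ e) λ k → h ≼-refl λ _ → k
Force-regular (s ≺ t) {e} h = decidable-stable (⟦ s ⟧ e <? ⟦ t ⟧ e) λ k → h ≼-refl λ _ → k
Force-regular (t ε X) {ν = ν} h = Name.regular (lookup ν X) h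
Force-regular ⊥̇ h = h ≼-refl λ _ → id
Force-regular (φ ⇒ ψ) h q≼p x = Force-regular ψ λ r≼q k →
  h (≼-trans r≼q q≼p) λ s≼r f → k s≼r (f ≼-refl (Force-mono φ (≼-trans s≼r r≼q) x))
Force-regular (φ ∧ ψ) h =
    Force-regular φ (λ q≼p k → h q≼p λ r≼q (x , _) → k r≼q x)
  , Force-regular ψ (λ q≼p k → h q≼p λ r≼q (_ , y) → k r≼q y)
Force-regular (∀ⁿ φ) h x = Force-regular φ λ q≼p k → h q≼p λ r≼q f → k r≼q (f x)
Force-regular (∀ˢ φ) h N = Force-regular φ λ q≼p k → h q≼p λ r≼q f → k r≼q (f N)

-- The hypothesis is the unfolded forcing of `∃ⁿ` or `∃ˢ`: witnesses are found at extensions, up to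
-- double negation.
∃-elim : ∀ {A : Set} {F : A → Cond → Set} →
         (∀ {q} → q ≼ p → (∀ x {r} → r ≼ q → F x r → ⊥) → ⊥) → ¬ ¬ ∃₂ λ x r → r ≼ p × F x r
∃-elim h k = h ≼-refl λ x r≼p f → k (x , _ , r≼p , f)

∨-elim : {F G : Cond → Set} →
         (∀ {q} → q ≼ p → (∀ {r} → r ≼ q → F r → ⊥) → G q) → ¬ ¬ ∃ λ r → r ≼ p × (F r ⊎ G r)
∨-elim h k = k (_ , ≼-refl , inj₂ (h ≼-refl λ r≼p f → k (_ , r≼p , inj₁ f)))

-- Substitution

eval-sub : {e : Vec ℕ n} {e′ : Vec ℕ n′} {σ : Fin n → Term n′} → (∀ i → ⟦ σ i ⟧ e′ ≡ lookup e i) →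
           ∀ t → ⟦ subᵗ σ t ⟧ e′ ≡ ⟦ t ⟧ e
eval-sub σ≡ (var i) = σ≡ i
eval-sub σ≡ 𝟎 = refl
eval-sub σ≡ 𝟏 = refl
eval-sub σ≡ (s ⊕ t) = cong₂ _+_ (eval-sub σ≡ s) (eval-sub σ≡ t)
eval-sub σ≡ (s ⊗ t) = cong₂ _*_ (eval-sub σ≡ s) (eval-sub σ≡ t)

eval-lift : ∀ {x} {e : Vec ℕ n} {e′ : Vec ℕ n′} {σ : Fin n → Term n′} → (∀ i → ⟦ σ i ⟧ e′ ≡ lookup e i) →
            ∀ i → ⟦ liftᵗ σ i ⟧ (x ∷ e′) ≡ lookup (x ∷ e) i
eval-lift σ≡ zero = refl
eval-lift {σ = σ} σ≡ (suc i) = trans (eval-sub (λ _ → refl) (σ i)) (σ≡ i)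

lookup-lift : ∀ {A : Set} {N : A} {ν : Vec A m} {ν′ : Vec A m′} {ρ : Fin m → Fin m′} →
              (∀ X → lookup ν′ (ρ X) ≡ lookup ν X) →
              ∀ X → lookup (N ∷ ν′) (lift 1 ρ X) ≡ lookup (N ∷ ν) X
lookup-lift ρ≡ zero = refl
lookup-lift ρ≡ (suc X) = ρ≡ X

Force-sub : (φ : Formula n m) {e : Vec ℕ n} {e′ : Vec ℕ n′} {ν : Vec Name m} {ν′ : Vec Name m′}
            {σ : Fin n → Term n′} {ρ : Fin m → Fin m′} →
            (∀ i → ⟦ σ i ⟧ e′ ≡ lookup e i) → (∀ X → lookup ν′ (ρ X) ≡ lookup ν X) →
            Force (sub σ ρ φ) e′ ν′ p ⟷ Force φ e ν p
Force-sub (s ≐ t) {e} σ≡ ρ≡ =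
  subst₂ (λ x y → x ≡ y ⟷ ⟦ s ⟧ e ≡ ⟦ t ⟧ e) (sym (eval-sub σ≡ s)) (sym (eval-sub σ≡ t)) (id , id)
Force-sub (s ≺ t) {e} σ≡ ρ≡ =
  subst₂ (λ x y → x < y ⟷ ⟦ s ⟧ e < ⟦ t ⟧ e) (sym (eval-sub σ≡ s)) (sym (eval-sub σ≡ t)) (id , id)
Force-sub {p = p} (t ε X) {e} {ν = ν} σ≡ ρ≡ =
  subst₂ (λ x N → Has N x p ⟷ Has (lookup ν X) (⟦ t ⟧ e) p) (sym (eval-sub σ≡ t)) (sym (ρ≡ X)) (id , id)
Force-sub ⊥̇ σ≡ ρ≡ = id , id
Force-sub (φ ⇒ ψ) σ≡ ρ≡ =
    (λ h q≼p x → proj₁ (Force-sub ψ σ≡ ρ≡) (h q≼p (proj₂ (Force-sub φ σ≡ ρ≡) x)))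
  , (λ h q≼p x → proj₂ (Force-sub ψ σ≡ ρ≡) (h q≼p (proj₁ (Force-sub φ σ≡ ρ≡) x)))
Force-sub (φ ∧ ψ) σ≡ ρ≡ =
    (λ (x , y) → proj₁ (Force-sub φ σ≡ ρ≡) x , proj₁ (Force-sub ψ σ≡ ρ≡) y)
  , (λ (x , y) → proj₂ (Force-sub φ σ≡ ρ≡) x , proj₂ (Force-sub ψ σ≡ ρ≡) y)
Force-sub (∀ⁿ φ) σ≡ ρ≡ =
    (λ h x → proj₁ (Force-sub φ (eval-lift σ≡) ρ≡) (h x))
  , (λ h x → proj₂ (Force-sub φ (eval-lift σ≡) ρ≡) (h x))
Force-sub (∀ˢ φ) σ≡ ρ≡ =
    (λ h N → proj₁ (Force-sub φ σ≡ (lookup-lift ρ≡)) (h N))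
  , (λ h N → proj₂ (Force-sub φ σ≡ (lookup-lift ρ≡)) (h N))

Force-wkⁿ : (φ : Formula n m) {x : ℕ} {e : Vec ℕ n} {ν : Vec Name m} →
            Force (wkⁿ φ) (x ∷ e) ν p ⟷ Force φ e ν p
Force-wkⁿ φ = Force-sub φ (λ _ → refl) (λ _ → refl)

Force-wkˢ : (φ : Formula n m) {N : Name} {e : Vec ℕ n} {ν : Vec Name m} →
            Force (wkˢ φ) e (N ∷ ν) p ⟷ Force φ e ν p
Force-wkˢ φ = Force-sub φ (λ _ → refl) (λ _ → refl)

Force-[]ⁿ : (φ : Formula (suc n) m) (t : Term n) {e : Vec ℕ n} {ν : Vec Name m} →
            Force (φ [ t ]ⁿ) e ν p ⟷ Force φ (⟦ t ⟧ e ∷ e) ν p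
Force-[]ⁿ φ t = Force-sub φ (λ { zero → refl ; (suc _) → refl }) (λ _ → refl)

Force-[]ˢ : (φ : Formula n (suc m)) (X : Fin m) {e : Vec ℕ n} {ν : Vec Name m} →
            Force (φ [ X ]ˢ) e ν p ⟷ Force φ e (lookup ν X ∷ ν) p
Force-[]ˢ φ X = Force-sub φ (λ _ → refl) (λ { zero → refl ; (suc _) → refl })

-- Soundness

_⊪_ : Cond → Theory → Set
p ⊪ T = ∀ {φ} → φ ∈ T → Force φ [] [] p

extend : ∀ {Γ : List (Formula n m)} (φ : Formula n m) {e ν} → q ≼ p → Force φ e ν q →
         (∀ {γ} → γ ∈ₗ Γ → Force γ e ν p) → ∀ {γ} → γ ∈ₗ φ ∷ Γ → Force γ e ν q
extend φ q≼p x hΓ (here refl) = x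
extend φ q≼p x hΓ {γ} (there γ∈Γ) = Force-mono γ q≼p (hΓ γ∈Γ)

-- The one classical rule, `raa`, is exactly regularity; the rest follows from monotonicity and
-- substitution.
sound : ∀ {T : Theory} {Γ : List (Formula n m)} {φ} → (∀ {p} → p ⊪ T) → T ∣ Γ ⊢ φ →
        ∀ {e ν p} → (∀ {γ} → γ ∈ₗ Γ → Force γ e ν p) → Force φ e ν p
sound ⊪T (axiom {φ} φ∈T) hΓ = proj₂ (Force-sub φ (λ ()) (λ ())) (⊪T φ∈T)
sound ⊪T (assume φ∈Γ) hΓ = hΓ φ∈Γ
sound ⊪T (⇒-intro {φ} d) hΓ q≼p x = sound ⊪T d (extend φ q≼p x hΓ)
sound ⊪T (⇒-elim d d′) hΓ = sound ⊪T d hΓ ≼-refl (sound ⊪T d′ hΓ)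
sound ⊪T (∧-intro d d′) hΓ = sound ⊪T d hΓ , sound ⊪T d′ hΓ
sound ⊪T (∧-elimˡ d) hΓ = proj₁ (sound ⊪T d hΓ)
sound ⊪T (∧-elimʳ d) hΓ = proj₂ (sound ⊪T d hΓ)
sound ⊪T (raa {φ} d) hΓ = Force-regular φ λ q≼p k → sound ⊪T d (extend (¬̇ φ) q≼p k hΓ)
sound ⊪T (∀ⁿ-intro d) hΓ x = sound ⊪T d λ γ∈ → case ∈-map⁻ wkⁿ γ∈ of λ where
  (γ , γ∈Γ , refl) → proj₂ (Force-wkⁿ γ) (hΓ γ∈Γ)
sound ⊪T (∀ⁿ-elim {φ} d t) hΓ = proj₂ (Force-[]ⁿ φ t) (sound ⊪T d hΓ _)
sound ⊪T (∀ˢ-intro d) hΓ N = sound ⊪T d λ γ∈ → case ∈-map⁻ wkˢ γ∈ of λ where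
  (γ , γ∈Γ , refl) → proj₂ (Force-wkˢ γ) (hΓ γ∈Γ)
sound ⊪T (∀ˢ-elim {φ} d X) hΓ = proj₂ (Force-[]ˢ φ X) (sound ⊪T d hΓ _)
sound ⊪T (≐-refl t) hΓ = refl
sound ⊪T (≐-subst φ {s} {t} d d′) {e} {ν} {p} hΓ =
  proj₂ (Force-[]ⁿ φ t) (subst (λ x → Force φ (x ∷ e) ν p) (sound ⊪T d hΓ)
    (proj₁ (Force-[]ⁿ φ s) (sound ⊪T d′ hΓ)))

-- Definability of forcing for arithmetical formulas

tm : (Fin n → Tm) → Term n → Tm
tm σ (var i) = σ i
tm σ 𝟎 = lit 0
tm σ 𝟏 = lit 1
tm σ (s ⊕ t) = tm σ s +ᵗ tm σ t
tm σ (s ⊗ t) = tm σ s *ᵗ tm σ t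

evalᵗ-tm : ∀ {ρ} {e : Vec ℕ n} {σ : Fin n → Tm} → (∀ i → evalᵗ (σ i) ρ ≡ lookup e i) →
           ∀ t → evalᵗ (tm σ t) ρ ≡ ⟦ t ⟧ e
evalᵗ-tm σ≡ (var i) = σ≡ i
evalᵗ-tm σ≡ 𝟎 = refl
evalᵗ-tm σ≡ 𝟏 = refl
evalᵗ-tm σ≡ (s ⊕ t) = cong₂ _+_ (evalᵗ-tm σ≡ s) (evalᵗ-tm σ≡ t)
evalᵗ-tm σ≡ (s ⊗ t) = cong₂ _*_ (evalᵗ-tm σ≡ s) (evalᵗ-tm σ≡ t)

extᵗ : (Fin n → Tm) → Fin (suc n) → Tm
extᵗ σ zero = ref 0
extᵗ σ (suc i) = shift (σ i)

evalᵗ-shifted : ∀ {ρ x y} (t : Tm) → evalᵗ t ρ ≡ y → evalᵗ (shift t) (x ∷ ρ) ≡ y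
evalᵗ-shifted t eq = trans (evalᵗ-shift t) eq

-- The two guarded quantifiers stand in for substitution: they place the code of the condition and
-- the number where the expression of `N` expects them, and `tail` disposes of the remaining
-- environment.
hasᶜ : Name → Tm → Tm → Expr
hasᶜ N π t = all (eqᶜ (ref 0) (shift t) ⊃ all (eqᶜ (ref 0) (shift (shift π)) ⊃ Name.expr N))

hasᶜ-correct : ∀ N π t {ρ x} → evalᵗ π ρ ≡ enc p → evalᵗ t ρ ≡ x → Sem (hasᶜ N π t) ρ ⟷ Has N x p
hasᶜ-correct {p = p} N π t {ρ} {x} π≡ t≡ =
    (λ h → Name.tail N p x
      (h x (proj₂ (eqᶜ-correct (ref 0) (shift t)) (sym (evalᵗ-shifted t t≡)))
         (enc p) (proj₂ (eqᶜ-correct (ref 0) (shift (shift π))) (sym (evalᵗ-shifted (shift π) (evalᵗ-shifted π π≡))))))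
  , λ h y y≡ z z≡ → subst₂ (λ y z → Sem (Name.expr N) (z ∷ y ∷ ρ))
      (sym (trans (proj₁ (eqᶜ-correct (ref 0) (shift t)) y≡) (evalᵗ-shifted t t≡)))
      (sym (trans (proj₁ (eqᶜ-correct (ref 0) (shift (shift π)) {z ∷ y ∷ ρ}) z≡)
                  (evalᵗ-shifted (shift π) (evalᵗ-shifted π π≡))))
      (Name.tail N p x h)

extendsᶜ : Tm → Tm → Expr
extendsᶜ s t = tableᶜ 6 (pairᵗ s t)

∀≼ᶜ : Tm → Expr → Expr
∀≼ᶜ π c = all (extendsᶜ (ref 0) (shift π) ⊃ c)

∀≼ᶜ-correct : ∀ c π {ρ} {F : Cond → Set} → evalᵗ π ρ ≡ enc p → (∀ q → Sem c (enc q ∷ ρ) ⟷ F q) →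
              Sem (∀≼ᶜ π c) ρ ⟷ (∀ {q} → q ≼ p → F q)
∀≼ᶜ-correct {p = p} c π {ρ} π≡ c≡ =
    (λ h {q} q≼p → proj₁ (c≡ q) (h (enc q) λ k →
      k (Table→B (extends q p (cong (pair (enc q)) (evalᵗ-shifted π π≡)) q≼p))))
  , λ h x x≼ → Sem-stable c λ k → x≼ λ b →
      case B→Table 6 (pair x (evalᵗ (shift π) (x ∷ ρ))) b of λ where
        (extends q p′ eq q≼p) → case pair-injective x (evalᵗ (shift π) (x ∷ ρ)) (enc q) (enc p′) eq of λ where
          (refl , eq′) → case enc-injective p p′ (trans (sym (evalᵗ-shifted π π≡)) eq′) of λ where
            refl → k (proj₂ (c≡ q) (h q≼p))

-- The term `π` denotes the code of the current condition. Only implication changes the condition;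
-- the new one becomes variable 0 and the number variables are shifted.
⟪_⟫ : {φ : Formula n m} → Arithmetical φ → Tm → (Fin n → Tm) → Vec Name m → Expr
⟪ s ≐ t ⟫ π σ ν = eqᶜ (tm σ s) (tm σ t)
⟪ s ≺ t ⟫ π σ ν = tableᶜ 4 (pairᵗ (tm σ s) (tm σ t))
⟪ t ε X ⟫ π σ ν = hasᶜ (lookup ν X) π (tm σ t)
⟪ ⊥̇ ⟫     π σ ν = ⊥ᶜ
⟪ a ⇒ b ⟫ π σ ν = ∀≼ᶜ π (⟪ a ⟫ (ref 0) (shift ∘ σ) ν ⊃ ⟪ b ⟫ (ref 0) (shift ∘ σ) ν)
⟪ a ∧ b ⟫ π σ ν = ⟪ a ⟫ π σ ν ∧ᶜ ⟪ b ⟫ π σ ν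
⟪ ∀ⁿ a ⟫  π σ ν = all (⟪ a ⟫ (shift π) (extᵗ σ) ν)

⟪⟫-correct : {φ : Formula n m} (a : Arithmetical φ) {π : Tm} {σ : Fin n → Tm} {ν : Vec Name m} {e : Vec ℕ n} →
             ∀ {ρ} → evalᵗ π ρ ≡ enc p → (∀ i → evalᵗ (σ i) ρ ≡ lookup e i) →
             Sem (⟪ a ⟫ π σ ν) ρ ⟷ Force φ e ν p
⟪⟫-correct (s ≐ t) {σ = σ} {ρ = ρ} π≡ σ≡ =
  subst₂ (λ x y → Sem (eqᶜ (tm σ s) (tm σ t)) ρ ⟷ x ≡ y)
    (evalᵗ-tm σ≡ s) (evalᵗ-tm σ≡ t) (eqᶜ-correct (tm σ s) (tm σ t))
⟪⟫-correct (s ≺ t) {σ = σ} {ρ = ρ} π≡ σ≡ =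
  subst₂ (λ x y → Sem (tableᶜ 4 (pairᵗ (tm σ s) (tm σ t))) ρ ⟷ x < y)
    (evalᵗ-tm σ≡ s) (evalᵗ-tm σ≡ t) (ltᶜ-correct (tm σ s) (tm σ t))
⟪⟫-correct (t ε X) {π} {σ} {ν} π≡ σ≡ = hasᶜ-correct (lookup ν X) π (tm σ t) π≡ (evalᵗ-tm {σ = σ} σ≡ t)
⟪⟫-correct ⊥̇ {ρ = ρ} π≡ σ≡ = ⊥ᶜ-elim {ρ} , ⊥-elim
⟪⟫-correct (_⇒_ {φ = φ} {ψ} a b) {π} {σ} {ν} {e} {ρ} π≡ σ≡ =
  ∀≼ᶜ-correct (⟪ a ⟫ (ref 0) (shift ∘ σ) ν ⊃ ⟪ b ⟫ (ref 0) (shift ∘ σ) ν) π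
    {F = λ q → Force φ e ν q → Force ψ e ν q} π≡ λ q →
      (λ h x → proj₁ (correct b q) (h (proj₂ (correct a q) x)))
    , (λ h x → proj₂ (correct b q) (h (proj₁ (correct a q) x)))
  where
  correct : ∀ {χ} (c : Arithmetical χ) q → Sem (⟪ c ⟫ (ref 0) (shift ∘ σ) ν) (enc q ∷ ρ) ⟷ Force χ e ν q
  correct c q = ⟪⟫-correct c refl λ i → evalᵗ-shifted (σ i) (σ≡ i)
⟪⟫-correct (a ∧ b) {π} {σ} {ν} π≡ σ≡ =
    (λ h → let x , y = proj₁ (∧ᶜ-correct c d) h in proj₁ (⟪⟫-correct a π≡ σ≡) x , proj₁ (⟪⟫-correct b π≡ σ≡) y)
  , (λ (x , y) → proj₂ (∧ᶜ-correct c d) (proj₂ (⟪⟫-correct a π≡ σ≡) x , proj₂ (⟪⟫-correct b π≡ σ≡) y))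
  where
  c = ⟪ a ⟫ π σ ν
  d = ⟪ b ⟫ π σ ν
⟪⟫-correct (∀ⁿ_ {φ} a) {π} {σ} {ν} {e} {ρ} π≡ σ≡ =
    (λ h x → proj₁ (correct x) (h x))
  , (λ h x → proj₂ (correct x) (h x))
  where
  correct : ∀ x → Sem (⟪ a ⟫ (shift π) (extᵗ σ) ν) (x ∷ ρ) ⟷ Force φ (x ∷ e) ν _
  correct x = ⟪⟫-correct a (evalᵗ-shifted π π≡) λ { zero → refl ; (suc i) → evalᵗ-shifted (σ i) (σ≡ i) }

-- For an implication, an extension `r` of `q` is replaced by `merge k r p`, which extends `p` and
-- looks like `r` below `k`.
Force-local : ∀ {k} {φ : Formula n m} (a : Arithmetical φ) {ν : Vec Name m} →
              (∀ X → Name.support (lookup ν X) ≤ k) → ∀ {e} → Local k (Force φ e ν)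
Force-local (s ≐ t) ν≤ p≈q h = h
Force-local (s ≺ t) ν≤ p≈q h = h
Force-local (t ε X) {ν} ν≤ p≈q h = Name.local (lookup ν X) (≈-≤ (ν≤ X) p≈q) h
Force-local (a ⇒ b) ν≤ {p = p} p≈q h {r} r≼q x =
  Force-local b ν≤ (merge-≈ _ r p) (h (merge-≼ (≼[]-trans (≼⇒≼[] r≼q) (≈⇒≼[] (≈-sym p≈q))))
    (Force-local a ν≤ (≈-sym (merge-≈ _ r p)) x))
Force-local (a ∧ b) ν≤ p≈q (h , k) = Force-local a ν≤ p≈q h , Force-local b ν≤ p≈q k
Force-local (∀ⁿ a) ν≤ p≈q h x = Force-local a ν≤ p≈q (h x)

supports : Vec Name m → ℕ
supports [] = 0
supports (N ∷ ν) = Name.support N ⊔ supports ν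

support≤ : (ν : Vec Name m) → ∀ X → Name.support (lookup ν X) ≤ supports ν
support≤ (N ∷ ν) zero = m≤m⊔n _ _
support≤ (N ∷ ν) (suc X) = ≤-trans (support≤ ν X) (m≤n⊔m (Name.support N) _)

-- Names for arithmetically definable sets

mkName : (F : ℕ → Cond → Set) (c : Expr) → (∀ p x ρ → Sem c (enc p ∷ x ∷ ρ) ⟷ F x p) →
         ∀ k → (∀ {x} → Mono (F x)) → (∀ {x} → Regular (F x)) → (∀ {x} → Local k (F x)) → Name
mkName F c c≡ k mono regular local = record
  { expr    = c
  ; tail    = λ p x h → proj₂ (c≡ p x _) (proj₁ (c≡ p x _) h)
  ; support = k
  ; mono    = λ q≼p h → proj₂ (c≡ _ _ []) (mono q≼p (proj₁ (c≡ _ _ []) h))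
  ; regular = λ h → proj₂ (c≡ _ _ []) (regular λ q≼p k → h q≼p λ r≼q x → k r≼q (proj₁ (c≡ _ _ []) x))
  ; local   = λ p≈q h → proj₂ (c≡ _ _ []) (local p≈q (proj₁ (c≡ _ _ []) h))
  }

module _ {φ : Formula (suc n) m} (a : Arithmetical φ) (e : Vec ℕ n) (ν : Vec Name m) where

  private
    σ : Fin (suc n) → Tm
    -- Variable 0 is the condition and variable 1 the candidate element; number parameters are built
    -- in as literals.
    σ zero = ref 1
    σ (suc i) = lit (lookup e i)

    correct : ∀ p x ρ → Sem (⟪ a ⟫ (ref 0) σ ν) (enc p ∷ x ∷ ρ) ⟷ Force φ (x ∷ e) ν p
    correct p x ρ = ⟪⟫-correct a refl λ { zero → refl ; (suc i) → refl }

  comprehend : Name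
  comprehend = mkName (λ x → Force φ (x ∷ e) ν) (⟪ a ⟫ (ref 0) σ ν) correct (supports ν)
    (Force-mono φ) (Force-regular φ) (Force-local a (support≤ ν))

  comprehend-has : ∀ {x p} → Has comprehend x p ⟷ Force φ (x ∷ e) ν p
  comprehend-has {x} {p} = correct p x []

-- The axioms of ACA₀ are forced

Force-∀*ˢ : ∀ m {φ : Formula 0 m} → (∀ ν → Force φ [] ν p) → Force (∀*ˢ m φ) [] [] p
Force-∀*ˢ zero h = h []
Force-∀*ˢ (suc m) h = Force-∀*ˢ m λ ν N → h (N ∷ ν)

Force-∀* : ∀ (φ : Formula n m) → (∀ e ν → Force φ e ν p) → Force (∀* φ) [] [] p
Force-∀* {n = zero} {m} φ h = Force-∀*ˢ m (h [])
Force-∀* {n = suc n} φ h = Force-∀* (∀ⁿ φ) λ e ν x → h (x ∷ e) ν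

ACA₀-forced : p ⊪ ACA₀
ACA₀-forced +1≢0 x _ = subst (_≢ 0) (+-comm 1 x) λ ()
ACA₀-forced +1-inj x y _ eq = +-cancelʳ-≡ 1 x y eq
ACA₀-forced ⊕-zero x = +-identityʳ x
ACA₀-forced ⊕-suc x y = sym (+-assoc x y 1)
ACA₀-forced ⊗-zero x = *-zeroʳ x
ACA₀-forced ⊗-suc x y = trans (*-distribˡ-+ x y 1) (cong (x * y +_) (*-identityʳ x))
ACA₀-forced ≺-zero x _ ()
ACA₀-forced ≺-suc x y =
    (λ _ x<y+1 _ x≮y → ≤-antisym (m<1+n⇒m≤n (subst (x <_) (+-comm y 1) x<y+1)) (≮⇒≥ (x≮y ≼-refl)))
  , (λ _ h → decidable-stable (x <? y + 1) λ k → k (subst (x <_) (+-comm 1 y)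
      (s≤s (≤-reflexive (h ≼-refl λ _ x<y → k (<-≤-trans x<y (m≤m+n y 1)))))))
ACA₀-forced induction N {q} q≼p (h₀ , hₛ) = go
  where
  go : ∀ x → Has N x q
  go zero = h₀
  go (suc x) = subst (λ y → Has N y q) (+-comm x 1) (hₛ x ≼-refl (go x))
ACA₀-forced (comprehension φ a) = Force-∀* (∃ˢ ∀ⁿ x₀ ε X₀ ⇔ wkˢ φ) λ e ν q≼p h → h (comprehend a e ν) ≼-refl λ x →
    (λ _ k → proj₂ (Force-wkˢ φ) (proj₁ (comprehend-has a e ν) k))
  , (λ _ k → proj₂ (comprehend-has a e ν) (proj₁ (Force-wkˢ φ) k))

arithmetical? : Formula n m → Bool
arithmetical? (s ≐ t) = true
arithmetical? (s ≺ t) = true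
arithmetical? (t ε X) = true
arithmetical? ⊥̇       = true
arithmetical? (φ ⇒ ψ) = arithmetical? φ && arithmetical? ψ
arithmetical? (φ ∧ ψ) = arithmetical? φ && arithmetical? ψ
arithmetical? (∀ⁿ φ)  = arithmetical? φ
arithmetical? (∀ˢ φ)  = false

arithmetical : (φ : Formula n m) → T (arithmetical? φ) → Arithmetical φ
arithmetical (s ≐ t) _ = s ≐ t
arithmetical (s ≺ t) _ = s ≺ t
arithmetical (t ε X) _ = t ε X
arithmetical ⊥̇ _ = ⊥̇
arithmetical (φ ⇒ ψ) h = let a , b = Equivalence.to T-∧ h in arithmetical φ a ⇒ arithmetical ψ b
arithmetical (φ ∧ ψ) h = let a , b = Equivalence.to T-∧ h in arithmetical φ a ∧ arithmetical ψ b
arithmetical (∀ⁿ φ) h = ∀ⁿ arithmetical φ h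

-- Failure of ATR₀

ground : (f : ℕ → ℕ) (t : Tm) → (∀ {y x ρ} → evalᵗ t (y ∷ x ∷ ρ) ≡ f x) → Name
ground f t t≡ = mkName (λ x _ → ¬ ¬ B (f x)) (mem t)
  (λ p x ρ → subst (λ y → ¬ ¬ B y) t≡ , subst (λ y → ¬ ¬ B y) (sym t≡))
  0 (λ _ h → h) (λ h k → h ≼-refl λ _ h′ → h′ k) (λ _ h → h)

B-name ω-name : Name
B-name = ground id (ref 1) refl
ω-name = ground (pair 5) (pairᵗ (lit 5) (ref 1)) refl

-- Membership in `ω-name` ignores the condition, so the statement at `[]` applies at all conditions.
ω-has : ∀ x y → Has ω-name (pair x y) [] ⟷ x ≤ y
ω-has x y =
    (λ h → decidable-stable (x ≤? y) λ k → h λ b → case B→Table 5 (pair x y) b of λ where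
      (leq x′ y′ eq x≤y) → case pair-injective x y x′ y′ eq of λ { (refl , refl) → k x≤y })
  , λ x≤y k → k (Table→B (leq x y refl x≤y))

ω-has⁻ : ∀ z → Has ω-name z [] → ¬ ¬ ∃₂ λ x y → z ≡ pair x y
ω-has⁻ z h k = h λ b → case B→Table 5 z b of λ { (leq x y eq _) → k (x , y , eq) }

Total Descending : Formula 0 2
Total = ∀ⁿ ∃ⁿ ⟨ x₁ , x₀ ⟩ ε X₀
Descending = ∀ⁿ ∀ⁿ ∀ⁿ ⟨ x₂ , x₁ ⟩ ε X₀ ∧ ⟨ x₂ ⊕ 𝟏 , x₀ ⟩ ε X₀ ⇒ x₀ <⟨ X₁ ⟩ x₁

-- Totality gives, at some extension, a value at `x + 1`, which is truly smaller than `v`; induction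
-- on `v` rules out even a generic descending sequence.
no-descent : ∀ F {v} → Acc _<_ v → ∀ x → let ν = F ∷ ω-name ∷ [] in
             Force Total [] ν p → Force Descending [] ν p → ¬ Has F (pair x v) p
no-descent F {v} (acc rec) x total descending h = ∃-elim (total (x + 1)) λ (w , q , q≼p , h′) →
  let w≤v , v≰w = descending x v w q≼p (Name.mono F q≼p h , h′) in
  no-descent F (rec (≰⇒> λ v≤w → v≰w ≼-refl (proj₂ (ω-has v w) v≤w))) (x + 1)
    (Force-mono Total {[]} {ν = ν} q≼p total) (Force-mono Descending {[]} {ν = ν} q≼p descending) h′
  where ν = F ∷ ω-name ∷ []

ω-wellOrder : ∀ {e : Vec ℕ n} {ν : Vec Name m} → Force (WellOrder X₀) e (ω-name ∷ ν) p
ω-wellOrder = (relation , field′ , transitive , antisymmetric , total) ,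
  λ _ h → ∃-elim h λ (F , r , _ , (_ , tot , _) , descending) →
    ∃-elim (tot 0) λ (v , s , s≼r , h) →
    no-descent F (<-wellFounded v) 0 (Force-mono Total {[]} {ν = F ∷ ω-name ∷ []} s≼r tot)
      (Force-mono Descending {[]} {ν = F ∷ ω-name ∷ []} s≼r descending) h
  where
  relation : ∀ z {q} → q ≼ _ → Has ω-name z q → _
  relation z _ h _ k = ω-has⁻ z h λ (x , y , eq) → k x ≼-refl λ _ k′ → k′ y ≼-refl eq
  field′ : ∀ x y {q} → q ≼ _ → Has ω-name (pair x y) q → _
  field′ x y _ _ = proj₂ (ω-has x x) ≤-refl , proj₂ (ω-has y y) ≤-refl
  transitive : ∀ x y z {q} → q ≼ _ → Has ω-name (pair x y) q × Has ω-name (pair y z) q → Has ω-name (pair x z) q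
  transitive x y z _ (h , k) = proj₂ (ω-has x z) (≤-trans (proj₁ (ω-has x y) h) (proj₁ (ω-has y z) k))
  antisymmetric : ∀ x y {q} → q ≼ _ → Has ω-name (pair x y) q × Has ω-name (pair y x) q → x ≡ y
  antisymmetric x y _ (h , k) = ≤-antisym (proj₁ (ω-has x y) h) (proj₁ (ω-has y x) k)
  total : ∀ x y {q} → q ≼ _ → _ → ∀ {r} → r ≼ q →
          (∀ {s} → s ≼ r → Has ω-name (pair x y) s → ⊥) → Has ω-name (pair y x) r
  total x y _ _ _ k = proj₂ (ω-has y x) (≰⇒≥ λ x≤y → k ≼-refl (proj₂ (ω-has x y) x≤y))

-- Truth of an expression from a set Z holding the rows of its subexpressions.
-- Their codes are smaller, so iterating this along ω gives a truth set.

truth-step : Formula 1 2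
truth-step = (∀ⁿ ⟨ 𝟎 , ⟨ x₁ , x₀ ⟩ ⟩ ε X₁ ⇒ x₀ ε X₁)
           ∧ (∀ⁿ ∀ⁿ ⟨ 𝟏 , ⟨ x₂ , ⟨ x₁ , x₀ ⟩ ⟩ ⟩ ε X₁ ⇒ x₁ ε X₀ ⇒ x₀ ε X₀)
           ∧ (∀ⁿ ⟨ 𝟏 ⊕ 𝟏 , ⟨ x₁ , x₀ ⟩ ⟩ ε X₁ ⇒ x₀ ε X₀)

key-injective : ∀ c ρ c′ ρ′ → key c ρ ≡ key c′ ρ′ → c ≡ c′ × ρ ≡ ρ′
key-injective c ρ c′ ρ′ eq =
  let c≡ , ρ≡ = pair-injective (encExpr c) (# ρ) (encExpr c′) (# ρ′) eq in
  encExpr-injective c c′ c≡ , #-injective ρ ρ′ ρ≡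

-- Codes are injective, so only the table entries for the outermost constructor of `c` mention its
-- key. The other conjuncts are vacuous, and the conjunction acts as a case distinction.
truth-step-correct : ∀ c ρ Z → (∀ c′ ρ′ {q} → q ≼ p → encExpr c′ < encExpr c → Has Z (row c′ ρ′) q ⟷ Sem c′ ρ′) →
                     Force truth-step (key c ρ ∷ []) (Z ∷ B-name ∷ []) p ⟷ Sem c ρ
truth-step-correct {p = p} c ρ Z Z-correct = to c Z-correct , from
  where
  to : ∀ c → (∀ c′ ρ′ {q} → q ≼ p → encExpr c′ < encExpr c → Has Z (row c′ ρ′) q ⟷ Sem c′ ρ′) →
       Force truth-step (key c ρ ∷ []) (Z ∷ B-name ∷ []) p → Sem c ρ
  to (mem t) _ (h , _) = h (evalᵗ t ρ) ≼-refl λ k → k (Table→B (value t ρ refl))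
  to (c ⊃ d) Z-correct (_ , h , _) x = proj₁ (Z-correct d ρ ≼-refl (⊃-<ʳ c d))
    (h (row c ρ) (row d ρ) ≼-refl (λ k → k (Table→B (implies c d ρ refl))) ≼-refl
       (proj₂ (Z-correct c ρ ≼-refl (⊃-<ˡ c d)) x))
  to (all c) Z-correct (_ , _ , h) x = proj₁ (Z-correct c (x ∷ ρ) ≼-refl (all-< c))
    (h (row c (x ∷ ρ)) ≼-refl λ k → k (Table→B (forall′ c x ρ refl)))
  from : Sem c ρ → Force truth-step (key c ρ ∷ []) (Z ∷ B-name ∷ []) p
  from h = values , implications , instances
    where
    a = key c ρ
    values : ∀ v {q} → q ≼ p → ¬ ¬ B (pair 0 (pair a v)) → ¬ ¬ B v
    values v _ b k = b λ b → case B→Table 0 (pair a v) b of λ where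
      (value t ρ′ eq) → case pair-injective a v (key (mem t) ρ′) (evalᵗ t ρ′) eq of λ where
        (eq , refl) → case key-injective c ρ (mem t) ρ′ eq of λ { (refl , refl) → h k }
    implications : ∀ y z {q} → q ≼ p → ¬ ¬ B (pair 1 (pair a (pair y z))) → ∀ {r} → r ≼ q → Has Z y r → Has Z z r
    implications y z q≼p b {r} r≼q hy = Sem-stable (Name.expr Z) λ k → b λ b →
      case B→Table 1 (pair a (pair y z)) b of λ where
      (implies c′ d ρ′ eq) →
       case pair-injective a (pair y z) (key (c′ ⊃ d) ρ′) (pair (row c′ ρ′) (row d ρ′)) eq of λ where
        (eq , eq′) → case pair-injective y z (row c′ ρ′) (row d ρ′) eq′ of λ where
          (refl , refl) → case key-injective c ρ (c′ ⊃ d) ρ′ eq of λ where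
            (refl , refl) → k (proj₂ (Z-correct d ρ (≼-trans r≼q q≼p) (⊃-<ʳ c′ d))
              (h (proj₁ (Z-correct c′ ρ (≼-trans r≼q q≼p) (⊃-<ˡ c′ d)) hy)))
    instances : ∀ y {q} → q ≼ p → ¬ ¬ B (pair 2 (pair a y)) → Has Z y q
    instances y q≼p b = Sem-stable (Name.expr Z) λ k → b λ b → case B→Table 2 (pair a y) b of λ where
      (forall′ c′ x ρ′ eq) → case pair-injective a y (key (all c′) ρ′) (row c′ (x ∷ ρ′)) eq of λ where
        (eq , refl) → case key-injective c ρ (all c′) ρ′ eq of λ where
          (refl , refl) → k (proj₂ (Z-correct c′ (x ∷ ρ) q≼p (all-< c′)) (h x))

initial-part : Formula 2 3
initial-part = ∃ⁿ ∃ⁿ x₂ ≐ ⟨ x₁ , x₀ ⟩ ∧ x₀ <⟨ X₁ ⟩ x₃ ∧ x₂ ε X₀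

-- Induction on the code of `c`. The part of `Y` before row `encExpr c` has a name by comprehension,
-- and it already holds the truth of all expressions with smaller codes.
hierarchy-truth : ∀ Y → Force (Hierarchy {n = 0} (sub var (lift 1 (2 ↑ʳ_)) truth-step) X₁ X₀) []
                              (Y ∷ ω-name ∷ B-name ∷ []) p →
                  ∀ c ρ {q} → q ≼ p → Has Y (row c ρ) q ⟷ Sem c ρ
hierarchy-truth {p = p} Y (_ , H) c = go c (<-wellFounded (encExpr c))
  where
  ν = Y ∷ ω-name ∷ B-name ∷ []
  go : ∀ c → Acc _<_ (encExpr c) → ∀ ρ {q} → q ≼ p → Has Y (row c ρ) q ⟷ Sem c ρ
  go c (acc rec) ρ q≼p =
      (λ h → proj₁ (truth-step-correct c ρ Z Z-correct) (proj₂ (proj₁ (H′ (key c ρ)) ≼-refl h)))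
    , (λ h → proj₂ (H′ (key c ρ)) ≼-refl (proj₂ (ω-has (encExpr c) (encExpr c)) ≤-refl
             , proj₂ (truth-step-correct c ρ Z Z-correct) h))
    where
    part = arithmetical initial-part tt
    Z = comprehend part (encExpr c ∷ []) ν
    H′ = H (encExpr c) Z q≼p λ x → (λ _ → proj₁ (comprehend-has part (encExpr c ∷ []) ν))
                                 , (λ _ → proj₂ (comprehend-has part (encExpr c ∷ []) ν))
    Z-correct : ∀ c′ ρ′ {r} → r ≼ _ → encExpr c′ < encExpr c → Has Z (row c′ ρ′) r ⟷ Sem c′ ρ′
    Z-correct c′ ρ′ r≼q c′<c =
        (λ h → Sem-stable c′ λ k →
          ∃-elim (proj₁ (comprehend-has part (encExpr c ∷ []) ν) h) λ (x , s , s≼r , h) →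
          ∃-elim h λ (y , t , t≼s , _ , _ , h) →
          k (proj₁ (go c′ (rec c′<c) ρ′ (≼-trans t≼s (≼-trans s≼r (≼-trans r≼q q≼p)))) h))
      , (λ h → proj₂ (comprehend-has part (encExpr c ∷ []) ν) λ s≼r k →
          k (key c′ ρ′) ≼-refl λ t≼s k′ → k′ (encExpr c′) ≼-refl
          ( refl
          , ( proj₂ (ω-has (encExpr c′) (encExpr c)) (<⇒≤ c′<c)
            , λ _ h → <⇒≱ c′<c (proj₁ (ω-has (encExpr c) (encExpr c′)) h))
          , proj₂ (go c′ (rec c′<c) ρ′ (≼-trans t≼s (≼-trans s≼r (≼-trans r≼q q≼p)))) h))

-- The variable x in place of encExpr c keeps Agda from computing that number.
no-truth-set : ∀ Y → ¬ (∀ c ρ x → encExpr c ≡ x → Has Y (pair (pair x (# ρ)) x) p ⟷ Sem c ρ)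
no-truth-set {p = p} Y truth = contradictory (encExpr liar) refl
  where
  -- If variable 0 is the code of an expression, this is its row at its own code; `1 + pair x 0` is
  -- `# (x ∷ [])`.
  self : Tm
  self = pairᵗ (pairᵗ (ref 0) (lit 1 +ᵗ pairᵗ (ref 0) (lit 0))) (ref 0)
  -- Tarski's argument: what `p` forces into `Y` is definable by an expression, with the code of `p`
  -- as a literal.
  liar : Expr
  liar = hasᶜ Y (lit (enc p)) self ⊃ ⊥ᶜ
  liar-has : ∀ x → Sem (hasᶜ Y (lit (enc p)) self) (x ∷ []) ⟷ Has Y (pair (pair x (# (x ∷ []))) x) p
  liar-has x = hasᶜ-correct Y (lit (enc p)) self refl refl
  contradictory : ∀ x → encExpr liar ≡ x → ⊥
  contradictory x eq = ¬liar λ h → ⊥-elim (¬liar (proj₁ truth-liar (proj₁ (liar-has x) h)))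
    where
    truth-liar : Has Y (pair (pair x (# (x ∷ []))) x) p ⟷ Sem liar (x ∷ [])
    truth-liar = truth liar (x ∷ []) x eq
    ¬liar : ¬ Sem liar (x ∷ [])
    ¬liar h = ⊥ᶜ-elim {x ∷ []} (h (proj₂ (liar-has x) (proj₂ truth-liar h)))

ATR₀-not-forced : ¬ (∀ {φ} → φ ∈ ATR₀ → Force φ [] [] [])
ATR₀-not-forced h = ∃-elim
  (h (recursion truth-step (arithmetical truth-step tt)) B-name ω-name ≼-refl (ω-wellOrder {e = []} {ν = B-name ∷ []}))
  λ (Y , p , _ , hierarchy) → no-truth-set Y λ { c ρ _ refl → hierarchy-truth Y hierarchy c ρ ≼-refl }

-- Absoluteness of the notions about finite sequences

entry-forced : ∀ {s i v} → Force {m = 0} (Entry x₀ x₁ x₂) (s ∷ i ∷ v ∷ []) [] p ⟷ s [ i ]= v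
entry-forced =
    (λ h k → ∃-elim h λ (l , _ , _ , h) → ∃-elim h λ (a , _ , _ , h) → ∃-elim h λ (d , _ , _ , h) →
      ∃-elim h λ (w , _ , _ , h) → k (l , a , d , w , h))
  , λ h _ k → h λ (l , a , d , w , h) →
      k l ≼-refl λ _ k → k a ≼-refl λ _ k → k d ≼-refl λ _ k → k w ≼-refl h

code-forced : ∀ {s} → Force {m = 0} (Code x₀) (s ∷ []) [] p ⟷ IsCode s
code-forced =
    (λ h k → ∃-elim h λ (l , _ , _ , h) → ∃-elim h λ (a , _ , _ , h) → ∃-elim h λ (d , _ , _ , h) → k (l , a , d , h))
  , λ h _ k → h λ (l , a , d , h) → k l ≼-refl λ _ k → k a ≼-refl λ _ k → k d ≼-refl h

⊑-forced : ∀ {s t} → Force {m = 0} (x₀ ⊑ x₁) (s ∷ t ∷ []) [] p ⟷ s ⊑ₛ t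
⊑-forced =
    (λ h i v h′ → proj₁ entry-forced (h i v ≼-refl (proj₂ entry-forced h′)))
  , λ h i v _ h′ → proj₂ entry-forced (h i v (proj₁ entry-forced h′))

string-forced : ∀ {s} → Force {m = 0} (String x₀) (s ∷ []) [] p ⟷ IsString s
string-forced =
    (λ (h , h′) → proj₁ code-forced h , λ x (x<s , code) (x⊑s , s⊑x) →
      h′ x ≼-refl (x<s , proj₂ code-forced code) ≼-refl (proj₂ ⊑-forced x⊑s , proj₂ ⊑-forced s⊑x))
  , λ (h , h′) → proj₂ code-forced h , λ x _ (x<s , code) _ (x⊑s , s⊑x) →
      h′ x (x<s , proj₁ code-forced code) (proj₁ ⊑-forced x⊑s , proj₁ ⊑-forced s⊑x)

-- Determinism of oracle machines

data Action (Y : Name) (s : Cond) (pc pc′ j v w : ℕ) : ℕ → Set where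
  increment : w ≡ v + 1 → pc′ ≡ pc + 1 → Action Y s pc pc′ j v w 0
  jump      : v ≡ 0 → w ≡ 0 → pc′ ≡ j → Action Y s pc pc′ j v w 1
  decrement : v ≡ w + 1 → pc′ ≡ pc + 1 → Action Y s pc pc′ j v w 1
  query-yes : Has Y v s → w ≡ 1 → pc′ ≡ pc + 1 → Action Y s pc pc′ j v w 2
  query-no  : (∀ {q} → q ≼ s → ¬ Has Y v q) → w ≡ 0 → pc′ ≡ pc + 1 → Action Y s pc pc′ j v w 2

record StepData (Y : Name) (e c d : ℕ) (s : Cond) : Set where
  field
    {pc pc′ reg j v w tag} : ℕ
    before-pc  : c [ 0 ]= pc
    after-pc   : d [ 0 ]= pc′
    before-reg : c [ reg + 1 ]= v
    after-reg  : d [ reg + 1 ]= w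
    frame      : ∀ i x → i ≢ 0 → i ≢ reg + 1 → d [ i ]= x → c [ i ]= x
    command    : e [ pc ]= pair tag (pair reg j)
    action     : Action Y s pc pc′ j v w tag

step→ : ∀ Y {e c d} → Force (Step x₀ X₀ x₁ x₂) (e ∷ c ∷ d ∷ []) (Y ∷ []) p →
        ¬ ¬ ∃ λ s → s ≼ p × StepData Y e c d s
step→ {p} Y {e} {c} {d} h k =
  ∃-elim h λ (pc , _ , ≼₁ , h) → ∃-elim h λ (pc′ , _ , ≼₂ , h) → ∃-elim h λ (reg , _ , ≼₃ , h) →
  ∃-elim h λ (j , _ , ≼₄ , h) → ∃-elim h λ (v , _ , ≼₅ , h) →
  ∃-elim h λ (w , t , ≼₆ , c₀ , d₀ , cᵣ , dᵣ , frame , h) →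
  let finish : ∀ {s tag} → s ≼ t → e [ pc ]= pair tag (pair reg j) → Action Y s pc pc′ j v w tag → ⊥
      finish s≼ command action =
        k (_ , ≼-trans s≼ (≼-trans ≼₆ (≼-trans ≼₅ (≼-trans ≼₄ (≼-trans ≼₃ (≼-trans ≼₂ ≼₁))))) , record
        { before-pc = proj₁ entry-forced c₀
        ; after-pc = proj₁ entry-forced d₀
        ; before-reg = proj₁ entry-forced cᵣ
        ; after-reg = proj₁ entry-forced dᵣ
        ; frame = λ i x i≢0 i≢r h → proj₁ entry-forced
            (proj₂ (frame i x ≼-refl ((λ _ → i≢0) , (λ _ → i≢r))) ≼-refl (proj₂ entry-forced h))
        ; command = command
        ; action = action
        })
  in
  ∨-elim h λ where
    (_ , s≼ , inj₁ (command , w≡ , q≡)) → finish s≼ (proj₁ entry-forced command) (increment w≡ q≡)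
    (_ , s≼ , inj₂ h) → ∨-elim h λ where
      (_ , s′≼ , inj₁ (command , h)) → ∨-elim h λ where
        (_ , s″≼ , inj₁ (v≡ , w≡ , q≡)) →
          finish (≼-trans s″≼ (≼-trans s′≼ s≼)) (proj₁ entry-forced command) (jump v≡ w≡ q≡)
        (_ , s″≼ , inj₂ (v≡ , q≡)) →
          finish (≼-trans s″≼ (≼-trans s′≼ s≼)) (proj₁ entry-forced command) (decrement v≡ q≡)
      (_ , s′≼ , inj₂ (command , h , q≡)) → ∨-elim h λ where
        (_ , s″≼ , inj₁ (hv , w≡)) →
          finish (≼-trans s″≼ (≼-trans s′≼ s≼)) (proj₁ entry-forced command) (query-yes hv w≡ q≡)
        (_ , s″≼ , inj₂ (hv , w≡)) →
          finish (≼-trans s″≼ (≼-trans s′≼ s≼)) (proj₁ entry-forced command) (query-no hv w≡ q≡)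

IsInitial : ℕ → ℕ → Set
IsInitial a c = c [ 0 ]= 0 × c [ 1 ]= a × (∀ i v → c [ suc (suc i) ]= v → v ≡ 0)

record Run (Y : Name) (e a b : ℕ) (s : Cond) : Set where
  field
    {trace len} : ℕ
    start : ¬ ¬ ∃ λ c → trace [ 0 ]= c × IsInitial a c
    steps : ∀ {t i c d} → t ≼ s → i < len → trace [ i ]= c → trace [ suc i ]= d →
            ¬ ¬ ∃ λ q → q ≼ t × StepData Y e c d q
    end   : ¬ ¬ ∃₂ λ c pc → trace [ len ]= c × c [ 0 ]= pc × (∀ x → ¬ e [ pc ]= x) × c [ 1 ]= b

Run-mono : ∀ {Y e a b} → Mono (Run Y e a b)
Run-mono q≼p R = record { start = start ; steps = λ t≼q → steps (≼-trans t≼q q≼p) ; end = end }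
  where open Run R

computes→ : ∀ Y {e a b} → Force (Computes x₀ X₀ x₁ x₂) (e ∷ a ∷ b ∷ []) (Y ∷ []) p →
            ¬ ¬ ∃ λ s → s ≼ p × Run Y e a b s
computes→ Y h k =
  ∃-elim h λ (z , _ , ≼₁ , h) → ∃-elim h λ (l , _ , ≼₂ , start , steps , end) →
  k (_ , ≼-trans ≼₂ ≼₁ , record
  { start = λ k → ∃-elim start λ (c , _ , _ , z₀ , c₀ , c₁ , rest) →
      k (c , proj₁ entry-forced z₀ , proj₁ entry-forced c₀ , proj₁ entry-forced c₁ , λ i v h →
        rest i v ≼-refl (proj₂ entry-forced (subst (λ x → c [ x ]= v) (2+≡ i) h)))
  ; steps = λ {_} {i} {c} {d} t≼s i<l zᵢ zᵢ₊₁ → step→ Y (steps i c d t≼s (i<l , proj₂ entry-forced zᵢ ,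
      proj₂ entry-forced (subst (λ x → z [ x ]= d) (+-comm 1 i) zᵢ₊₁)))
  ; end = λ k → ∃-elim end λ (c , _ , _ , zₗ , h , c₁) → ∃-elim h λ (pc , _ , _ , c₀ , stop) →
      k (c , pc , proj₁ entry-forced zₗ , proj₁ entry-forced c₀
        , (λ x h → stop ≼-refl λ _ k → k x ≼-refl (proj₂ entry-forced h)) , proj₁ entry-forced c₁)
  })
  where
  2+≡ : ∀ i → suc (suc i) ≡ i + 1 + 1
  2+≡ i = trans (+-comm 2 i) (sym (+-assoc i 1 1))

-- The conditions may be incompatible, so agreement is stated by exclusion: below `b`, no extension
-- of one puts a number into `Y` that an extension of the other forces out.
Agree : Name → Cond → Cond → ℕ → Set
Agree Y s t b = ∀ {v q r} → v < b → q ≼ s → r ≼ t →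
  ¬ (Has Y v q × (∀ {r′} → r′ ≼ r → ¬ Has Y v r′)) × ¬ (Has Y v r × (∀ {q′} → q′ ≼ q → ¬ Has Y v q′))

action-deterministic : ∀ {Y s t b q r pc j v tag pc′ w pc″ w′} → Agree Y s t b → q ≼ s → r ≼ t → v < b →
  Action Y q pc pc′ j v w tag → Action Y r pc pc″ j v w′ tag → pc′ ≡ pc″ × w ≡ w′
action-deterministic _ _ _ _ (increment refl refl) (increment refl refl) = refl , refl
action-deterministic _ _ _ _ (jump refl refl refl) (jump _ refl refl) = refl , refl
action-deterministic {w′ = w′} _ _ _ _ (jump refl _ _) (decrement eq _) = case trans eq (+-comm w′ 1) of λ ()
action-deterministic {w = w} _ _ _ _ (decrement eq _) (jump refl _ _) = case trans eq (+-comm w 1) of λ ()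
action-deterministic {w = w} {w′ = w′} _ _ _ _ (decrement refl refl) (decrement eq refl) =
  refl , +-cancelʳ-≡ 1 w w′ eq
action-deterministic _ _ _ _ (query-yes _ refl refl) (query-yes _ refl refl) = refl , refl
action-deterministic agree q≼s r≼t v<b (query-yes h _ _) (query-no k _ _) = ⊥-elim (proj₁ (agree v<b q≼s r≼t) (h , k))
action-deterministic agree q≼s r≼t v<b (query-no k _ _) (query-yes h _ _) = ⊥-elim (proj₂ (agree v<b q≼s r≼t) (h , k))
action-deterministic _ _ _ _ (query-no _ refl refl) (query-no _ refl refl) = refl , refl

-- Equality would be too much to ask: configurations may have different
-- numbers of registers.
Compatible : ℕ → ℕ → Set
Compatible c c′ = ∀ i v v′ → c [ i ]= v → c′ [ i ]= v′ → v ≡ v′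

-- A queried number is an entry of `c` and hence at most its code, so `c < b` brings every query
-- under the agreement.
step-deterministic : ∀ {Y s t b q r e c c′ d d′} → Agree Y s t b → c < b → q ≼ s → r ≼ t →
  StepData Y e c d q → StepData Y e c′ d′ r → Compatible c c′ → Compatible d d′
step-deterministic {Y} {s} {t} {b} {q} {r} {e} {c} {c′} {d} {d′} agree c<b q≼s r≼t S S′ c~c′ = go
  where
  module S = StepData S
  module S′ = StepData S′
  same-pc : S.pc ≡ S′.pc
  same-pc = c~c′ 0 _ _ S.before-pc S′.before-pc
  same-command : pair S.tag (pair S.reg S.j) ≡ pair S′.tag (pair S′.reg S′.j)
  same-command = entry-unique S.command (subst (λ x → e [ x ]= _) (sym same-pc) S′.command)
  same-tag : S.tag ≡ S′.tag × pair S.reg S.j ≡ pair S′.reg S′.j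
  same-tag = pair-injective S.tag (pair S.reg S.j) S′.tag (pair S′.reg S′.j) same-command
  same-reg : S.reg ≡ S′.reg × S.j ≡ S′.j
  same-reg = pair-injective S.reg S.j S′.reg S′.j (proj₂ same-tag)
  same-v : S.v ≡ S′.v
  same-v = c~c′ (S.reg + 1) _ _ S.before-reg (subst (λ x → c′ [ x + 1 ]= S′.v) (sym (proj₁ same-reg)) S′.before-reg)
  transport : ∀ {pc j v tag pc° j° v° tag°} → pc ≡ pc° → j ≡ j° → v ≡ v° → tag ≡ tag° → ∀ {pc′ w} →
              Action Y r pc° pc′ j° v° w tag° → Action Y r pc pc′ j v w tag
  transport refl refl refl refl h = h
  same : S.pc′ ≡ S′.pc′ × S.w ≡ S′.w
  same = action-deterministic agree q≼s r≼t (≤-<-trans (entry-value≤ S.before-reg) c<b)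
    S.action (transport same-pc (proj₂ same-reg) same-v (proj₁ same-tag) S′.action)
  after-reg′ : d′ [ S.reg + 1 ]= S′.w
  after-reg′ = subst (λ x → d′ [ x + 1 ]= S′.w) (sym (proj₁ same-reg)) S′.after-reg
  go : Compatible d d′
  go i v v′ h h′ with i ≟ 0 | i ≟ S.reg + 1
  ... | yes refl | _ = trans (entry-unique h S.after-pc) (trans (proj₁ same) (entry-unique S′.after-pc h′))
  ... | no _ | yes refl = trans (entry-unique h S.after-reg) (trans (proj₂ same) (entry-unique after-reg′ h′))
  ... | no i≢0 | no i≢r = c~c′ i v v′ (S.frame i v i≢0 i≢r h)
    (S′.frame i v′ i≢0 (subst (λ x → i ≢ x + 1) (proj₁ same-reg) i≢r) h′)

-- Only the bound on the queries of the first run matters, since the second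
-- run makes the same queries as long as the oracles agree.
run-deterministic : ∀ {Y s t b e a x x′} (R : Run Y e a x s) (R′ : Run Y e a x′ t) →
  Run.trace R < b → Agree Y s t b → x ≡ x′
run-deterministic {Y} {s} {t} {b} {e} {a} {x} {x′} R R′ trace<b agree = decidable-stable (x ≟ x′) λ x≢x′ →
  R.end λ (c , pc , zₗ , c₀ , stop , c₁) → R′.end λ (c′ , pc′ , zₗ′ , c₀′ , stop′ , c₁′) →
  case <-cmp R.len R′.len of λ where
    (tri≈ _ eq _) → x≢x′ (compatible R.len ≤-refl (≤-reflexive eq) zₗ
      (subst (λ l → R′.trace [ l ]= c′) (sym eq) zₗ′) 1 x x′ c₁ c₁′)
    -- The longer run makes a further step at the counter where the shorter one has halted, so the
    -- program does have an instruction there.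
    (tri< lt _ _) → entry-below zₗ′ lt λ (d , z₊) → entry-below zₗ′ (<⇒≤ lt) λ (c″ , z) →
      R′.steps ≼-refl lt z z₊ λ (q , _ , S) → stop _ (subst (λ y → e [ y ]= _)
        (sym (compatible R.len ≤-refl (<⇒≤ lt) zₗ z 0 _ _ c₀ (StepData.before-pc S))) (StepData.command S))
    (tri> _ _ gt) → entry-below zₗ gt λ (d , z₊) → entry-below zₗ (<⇒≤ gt) λ (c″ , z) →
      R.steps ≼-refl gt z z₊ λ (q , _ , S) → stop′ _ (subst (λ y → e [ y ]= _)
        (compatible R′.len (<⇒≤ gt) ≤-refl z zₗ′ 0 _ _ (StepData.before-pc S) c₀′) (StepData.command S))
  where
  module R = Run R
  module R′ = Run R′
  compatible : ∀ i → i ≤ R.len → i ≤ R′.len → ∀ {c c′} → R.trace [ i ]= c → R′.trace [ i ]= c′ → Compatible c c′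
  compatible zero _ _ {c} {c′} z z′ j v v′ h h′ = decidable-stable (v ≟ v′) λ v≢v′ →
    R.start λ (d , zd , d₀ , d₁ , d₂) → R′.start λ (d′ , zd′ , d₀′ , d₁′ , d₂′) →
    case entry-unique z zd , entry-unique z′ zd′ of λ where
      (refl , refl) → v≢v′ (initial d₀ d₁ d₂ d₀′ d₁′ d₂′ j h h′)
    where
    initial : c [ 0 ]= 0 → c [ 1 ]= a → (∀ i v → c [ suc (suc i) ]= v → v ≡ 0) →
              c′ [ 0 ]= 0 → c′ [ 1 ]= a → (∀ i v → c′ [ suc (suc i) ]= v → v ≡ 0) →
              ∀ j → c [ j ]= v → c′ [ j ]= v′ → v ≡ v′
    initial d₀ d₁ d₂ d₀′ d₁′ d₂′ zero h h′ = trans (entry-unique h d₀) (entry-unique d₀′ h′)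
    initial d₀ d₁ d₂ d₀′ d₁′ d₂′ (suc zero) h h′ = trans (entry-unique h d₁) (entry-unique d₁′ h′)
    initial d₀ d₁ d₂ d₀′ d₁′ d₂′ (suc (suc j)) h h′ = trans (d₂ j v h) (sym (d₂′ j v′ h′))
  compatible (suc i) i< i<′ {d} {d′} z z′ j v v′ h h′ = decidable-stable (v ≟ v′) λ v≢v′ →
    entry-below z (n≤1+n i) λ (c , zc) → entry-below z′ (n≤1+n i) λ (c′ , zc′) →
    R.steps ≼-refl i< zc z λ (q , q≼s , S) → R′.steps ≼-refl i<′ zc′ z′ λ (r , r≼t , S′) →
    v≢v′ (step-deterministic agree (≤-<-trans (entry-value≤ zc) trace<b) q≼s r≼t S S′
      (compatible i (<⇒≤ i<) (<⇒≤ i<′) zc zc′) j v v′ h h′)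

-- Weak Martin's pointed tree theorem

genericᶜ : ℕ → Expr
genericᶜ k = tableᶜ 8 (pairᵗ (ref 0) (pairᵗ (lit k) (ref 1)))

genericᶜ-correct : ∀ k p x ρ → Sem (genericᶜ k) (enc p ∷ x ∷ ρ) ⟷ look p k x ≡ just true
genericᶜ-correct k p x ρ =
    (λ h → decidable-stable (≡-dec _≟ᵇ_ (look p k x) (just true)) λ ≢ → h λ b →
      case B→Table 8 (pair (enc p) (pair k x)) b of λ where
        (bit-on p′ i y eq on) → case pair-injective (enc p) (pair k x) (enc p′) (pair i y) eq of λ where
          (eq , eq′) → case enc-injective p p′ eq , pair-injective k x i y eq′ of λ where
            (refl , refl , refl) → ≢ on)
  , λ on k′ → k′ (Table→B (bit-on p k x refl on))

-- A bit that is not yet true is false, or can be made false by an extension, and then stays false.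
look-regular : ∀ k x → Regular (λ p → look p k x ≡ just true)
look-regular k x {p} h with look p k x in eq
... | just true = refl
... | just false = ⊥-elim (h ≼-refl λ (≼-by r≼p) on → case trans (sym on) (r≼p k x eq) of λ ())
... | nothing = ⊥-elim (h (decide-≼ k x false p eq) λ (≼-by r≼) on →
  case trans (sym on) (r≼ k x (decide-look k x false p)) of λ ())

generic : ℕ → Name
generic k = mkName (λ x p → look p k x ≡ just true) (genericᶜ k) (genericᶜ-correct k)
  (suc k) (λ {x} (≼-by q≼p) → q≼p k x) (λ {x} → look-regular k x)
  (λ {x} (≈-by p≈q) → trans (sym (p≈q k x ≤-refl)))

generic-has : ∀ k x p → Has (generic k) x p ⟷ look p k x ≡ just true
generic-has k x p = genericᶜ-correct k p x []

update : (ℕ → ℕ) → ℕ → ℕ → ℕ → ℕ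
update f l v i with i ≟ l
... | yes _ = v
... | no _  = f i

in-path : Formula 1 1
in-path = String x₀ ∧ (∀ⁿ ∀ⁿ Entry x₂ x₁ x₀ ⇒ ⟨ x₁ , x₀ ⟩ ε X₀)

-- The subtree of strings that can be forced onto the path

module PerfectSubtree
  (T Y : Name) (e : ℕ) (r : Cond)
  (path : Force (Path X₀ X₁) [] (Y ∷ T ∷ []) r)
  (reducible : Force (∀ⁿ (x₀ ε X₀ ⇒ Computes x₁ X₁ x₀ 𝟏) ∧ (¬̇ x₀ ε X₀ ⇒ Computes x₁ X₁ x₀ 𝟎))
                     (e ∷ []) (generic (Name.support T) ∷ Y ∷ []) r)
  where

  k : ℕ
  k = Name.support T

  OnPath : ℕ → Cond → Set
  OnPath σ s = Force in-path (σ ∷ []) (Y ∷ []) s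

  onPath : ∀ {σ s} → IsString σ → (∀ i v → σ [ i ]= v → Has Y (pair i v) s) → OnPath σ s
  onPath string h = proj₂ string-forced string , λ i v q≼s h′ → Name.mono Y q≼s (h i v (proj₁ entry-forced h′))

  onPath-string : ∀ {σ s} → OnPath σ s → IsString σ
  onPath-string (h , _) = proj₁ string-forced h

  onPath-value : ∀ {σ s i v} → OnPath σ s → σ [ i ]= v → Has Y (pair i v) s
  onPath-value (_ , h) h′ = h _ _ ≼-refl (proj₂ entry-forced h′)

  onPath-mono : ∀ {σ s t} → t ≼ s → OnPath σ s → OnPath σ t
  onPath-mono {σ} = Force-mono in-path {σ ∷ []} {ν = Y ∷ []}

  onPath-T : ∀ {σ s} → s ≼ r → OnPath σ s → Has T σ s
  onPath-T s≼r h = proj₂ path _ s≼r h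

  Y-unique : ∀ {s} x y y′ → s ≼ r → Has Y (pair x y) s → Has Y (pair x y′) s → y ≡ y′
  Y-unique x y y′ s≼r h h′ = proj₂ (proj₂ (proj₁ path)) x y y′ s≼r (h , h′)

  Y-pair : ∀ {s z} → s ≼ r → Has Y z s → ¬ ¬ ∃₂ λ x y → z ≡ pair x y
  Y-pair s≼r h k = ∃-elim (proj₁ (proj₁ path) _ s≼r h) λ (x , _ , _ , h) →
    ∃-elim h λ (y , _ , _ , eq) → k (x , y , eq)

  decide-values : ∀ l {s} → s ≼ r → ¬ ¬ ∃ λ (f : ℕ → ℕ) → ∃ λ t → t ≼ s × (∀ i → i < l → Has Y (pair i (f i)) t)
  decide-values zero s≼r c = c ((λ _ → 0) , _ , ≼-refl , λ _ ())
  decide-values (suc l) s≼r c = decide-values l s≼r λ (f , t , t≼s , h) →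
    ∃-elim (λ {q} q≼t → proj₁ (proj₂ (proj₁ path)) l {q} (≼-trans q≼t (≼-trans t≼s s≼r))) λ (v , t′ , t′≼t , h′) →
    c (update f l v , t′ , ≼-trans t′≼t t≼s , values f v (λ i i<l → Name.mono Y t′≼t (h i i<l)) h′)
    where
    values : ∀ f v {t} → (∀ i → i < l → Has Y (pair i (f i)) t) → Has Y (pair l v) t →
             ∀ i → i < suc l → Has Y (pair i (update f l v i)) t
    values f v h h′ i i<1+l with i ≟ l
    ... | yes refl = h′
    ... | no i≢l = h i (≤∧≢⇒< (m<1+n⇒m≤n i<1+l) i≢l)

  decide-path : ∀ l {s} → s ≼ r → ¬ ¬ ∃ λ f → ∃₂ λ τ t → t ≼ s × OnPath τ t × Lists τ l f
  decide-path l s≼r k = decide-values l s≼r λ (f , t , t≼s , h) → string-exists f l λ (τ , string , lists) →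
    k (f , τ , t , t≼s , onPath string (λ i v h′ → case proj₁ (lists i v) h′ of λ { (i<l , refl) → h i i<l }) , lists)

  -- σ belongs to S if a condition below r that is compatible with the first
  -- k generic sets forces σ to be an initial segment of Y.
  InS : ℕ → Cond → Set
  InS σ p = ∀ {q} → q ≼ p → ¬ ¬ ∃ λ s → s ≼ r × s ≼[ k ] q × OnPath σ s

  in-path-arithmetical : Arithmetical in-path
  in-path-arithmetical = arithmetical in-path tt

  guardᶜ bodyᶜ exprS : Expr
  -- The environment here begins with the codes of `s`, `q` and `p`, so the string is variable 3.
  bodyᶜ = ⟪ in-path-arithmetical ⟫ (ref 0) (λ _ → ref 3) (Y ∷ [])
  guardᶜ = all (extendsᶜ (ref 0) (lit (enc r)) ⊃ tableᶜ 7 (pairᵗ (lit k) (pairᵗ (ref 0) (ref 1))) ⊃ bodyᶜ ⊃ ⊥ᶜ) ⊃ ⊥ᶜ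
  exprS = ∀≼ᶜ (ref 0) guardᶜ

  exprS-correct : ∀ p x ρ → Sem exprS (enc p ∷ x ∷ ρ) ⟷ InS x p
  exprS-correct p x ρ = ∀≼ᶜ-correct guardᶜ (ref 0) refl λ q → to q , from q
    where
    body : ∀ s q → Sem bodyᶜ (enc s ∷ enc q ∷ enc p ∷ x ∷ ρ) ⟷ OnPath x s
    body s q = ⟪⟫-correct in-path-arithmetical {ref 0} {λ _ → ref 3} {Y ∷ []} {x ∷ []} refl λ { zero → refl }
    to : ∀ q → Sem guardᶜ (enc q ∷ enc p ∷ x ∷ ρ) → ¬ ¬ ∃ λ s → s ≼ r × s ≼[ k ] q × OnPath x s
    to q h c = ⊥ᶜ-elim {ρ} (h λ y s≼r s≼q b → ⊥-elim (s≼r λ t → s≼q λ t′ →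
      case B→Table 6 (pair y (enc r)) t of λ where
        (extends s r′ eq s≼r) → case pair-injective y (enc r) (enc s) (enc r′) eq of λ where
          (refl , eq) → case enc-injective r r′ eq , B→Table 7 (pair k (pair (enc s) (enc q))) t′ of λ where
            (refl , extendsₖ k′ s′ q′ eq s≼q) →
             case pair-injective k (pair (enc s) (enc q)) k′ (pair (enc s′) (enc q′)) eq of λ where
              (refl , eq) → case pair-injective (enc s) (enc q) (enc s′) (enc q′) eq of λ where
                (eq , eq′) → case enc-injective s s′ eq , enc-injective q q′ eq′ of λ where
                  (refl , refl) → c (s , s≼r , s≼q , proj₁ (body s q) b)))
    from : ∀ q → (¬ ¬ ∃ λ s → s ≼ r × s ≼[ k ] q × OnPath x s) → Sem guardᶜ (enc q ∷ enc p ∷ x ∷ ρ)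
    from q h f = ⊥-elim (h λ (s , s≼r , s≼q , b) → ⊥ᶜ-elim {ρ} (f (enc s)
      (λ c → c (Table→B (extends s r refl s≼r))) (λ c → c (Table→B (extendsₖ k s q refl s≼q))) (proj₂ (body s q) b)))

  S : Name
  S = mkName InS exprS exprS-correct k
    (λ q≼p h r≼q → h (≼-trans r≼q q≼p))
    (λ h q≼p c → h q≼p λ r≼q h′ → h′ ≼-refl λ (s , s≼r , s≼ , b) → c (s , s≼r , ≼[]-trans s≼ (≼⇒≼[] r≼q) , b))
    (λ {_} {p} p≈p′ h {q} q≼p′ c → h (merge-≼ (≼[]-trans (≼⇒≼[] q≼p′) (≈⇒≼[] (≈-sym p≈p′))))
      λ (s , s≼r , s≼ , b) → c (s , s≼r , ≼[]-trans s≼ (≈⇒≼[] (merge-≈ k q p)) , b))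

  S-has : ∀ {σ p} → Has S σ p ⟷ InS σ p
  S-has = exprS-correct _ _ []

  -- The witness `s` forces the string into `T`. As `T` has support `k`, so does `merge k s q`,
  -- which extends `q`; regularity of `T` concludes.
  S⊆T : Force (X₀ ⊆̇ X₁) [] (S ∷ T ∷ []) r
  S⊆T σ {p} p≼r σ∈S = Name.regular T λ {q} q≼p c → proj₁ S-has σ∈S q≼p λ (s , s≼r , s≼q , b) →
    c (merge-≼ s≼q) (Name.local T (≈-sym (merge-≈ k s q)) (onPath-T s≼r b))

  S-tree : Force (Tree X₀) [] (S ∷ []) r
  S-tree =
      (λ σ p≼r σ∈S → Force-regular (String x₀) {e = σ ∷ []} {ν = []} λ q≼p c →
        proj₁ S-has σ∈S q≼p λ (_ , _ , _ , b) →
        c ≼-refl (proj₂ string-forced (onPath-string b)))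
    , λ τ σ p≼r (τ∈S , string , σ⊑τ) → proj₂ S-has λ q≼p c → proj₁ S-has τ∈S q≼p λ (s , s≼r , s≼q , b) →
        c (s , s≼r , s≼q , onPath (proj₁ string-forced string) λ i v h → onPath-value b (proj₁ ⊑-forced σ⊑τ i v h))

  -- Indices of entries of `σ` are below its code, so `σ ≤ l` makes `τ` long enough;
  -- single-valuedness of `Y` makes the entries equal.
  path-⊑ : ∀ {σ τ s t l f} → t ≼ r → t ≼ s → OnPath σ s → OnPath τ t → Lists τ l f → σ ≤ l → σ ⊑ₛ τ
  path-⊑ {f = f} t≼r t≼s b b′ lists σ≤l i v h = proj₂ (lists i v) (i<l , Y-unique i v (f i) t≼r
    (Name.mono Y t≼s (onPath-value b h)) (onPath-value b′ (proj₂ (lists i (f i)) (i<l , refl))))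
    where i<l = <-≤-trans (entry-index< h) σ≤l

  -- A query `pair x y` below `l` concerns the value of the path at `x < l`. That value is an entry
  -- of `σ` and hence also of `τ`, so both conditions give the same answer.
  ⊑-agree : ∀ {σ τ s t l f} → s ≼ r → t ≼ r → OnPath σ s → OnPath τ t → Lists σ l f → σ ⊑ₛ τ → Agree Y s t l
  ⊑-agree {f = f} s≼r t≼r b b′ lists σ⊑τ {q = q} {q′} v<l q≼s q′≼t =
      (λ (h , h′) → Y-pair (≼-trans q≼s s≼r) h λ { (x , y , refl) →
        h′ ≼-refl (subst (λ y → Has Y (pair x y) q′)
          (Y-unique x (f x) y (≼-trans q≼s s≼r) (in-q x y v<l) h) (in-q′ x y v<l)) })
    , (λ (h , h′) → Y-pair (≼-trans q′≼t t≼r) h λ { (x , y , refl) →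
        h′ ≼-refl (subst (λ y → Has Y (pair x y) q)
          (Y-unique x (f x) y (≼-trans q′≼t t≼r) (in-q′ x y v<l) h) (in-q x y v<l)) })
    where
    entry : ∀ x y → pair x y < _ → _ [ x ]= f x
    entry x y v<l = proj₂ (lists x (f x)) (≤-<-trans (pair-≥ˡ x y) v<l , refl)
    in-q : ∀ x y → pair x y < _ → Has Y (pair x (f x)) q
    in-q x y v<l = Name.mono Y q≼s (onPath-value b (entry x y v<l))
    in-q′ : ∀ x y → pair x y < _ → Has Y (pair x (f x)) q′
    in-q′ x y v<l = Name.mono Y q′≼t (onPath-value b′ (σ⊑τ x (f x) (entry x y v<l)))

  -- Any extension of `q` can be merged with `t` into a condition below `t`, which still forces `τ`
  -- onto the path.
  inS : ∀ {τ t q} → t ≼ r → OnPath τ t → q ≼[ k ] t → Has S τ q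
  inS {t = t} t≼r b q≼t = proj₂ S-has λ {q′} q′≼q c →
    let m≼t = merge-≼ (≼[]-trans (≼⇒≼[] q′≼q) q≼t)
    in c (merge k q′ t , ≼-trans m≼t t≼r , ≈⇒≼[] (merge-≈ k q′ t) , onPath-mono m≼t b)

  computes-at : ∀ {a s} → s ≼ r →
                (look s k a ≡ just true → ¬ ¬ ∃ λ t → t ≼ s × Run Y e a 1 t) ×
                (look s k a ≡ just false → ¬ ¬ ∃ λ t → t ≼ s × Run Y e a 0 t)
  computes-at {a} {s} s≼r =
      (λ on → computes→ Y (proj₁ (reducible a) s≼r (proj₂ (generic-has k a s) on)))
    , (λ off → computes→ Y (proj₂ (reducible a) s≼r λ { {q} (≼-by q≼s) on →
        case trans (sym (q≼s k a off)) (proj₁ (generic-has k a q) on) of λ () }))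

  record Splitting (σ : ℕ) (p : Cond) : Set where
    field
      {τ₀ τ₁}   : ℕ
      {p′}      : Cond
      p′≼p      : p′ ≼ p
      τ₀∈S      : Has S τ₀ p′
      τ₁∈S      : Has S τ₁ p′
      σ⊑τ₀      : σ ⊑ₛ τ₀
      σ⊑τ₁      : σ ⊑ₛ τ₁
      τ₀⋢τ₁     : ¬ τ₀ ⊑ₛ τ₁
      τ₁⋢τ₀     : ¬ τ₁ ⊑ₛ τ₀

  -- A bit of Gₖ is free while the coordinates below `k` are fixed. Either choice of the bit keeps
  -- `σ` on the path, but the program must output different values, so the path must be continued
  -- differently.
  split : ∀ {σ p} → Has S σ p → ¬ ¬ Splitting σ p
  split {σ} {p} σ∈S c = proj₁ S-has σ∈S ≼-refl λ (s , s≼r , s≼p , b) →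
    -- A place at which `s` leaves every generic set undecided.
    let a = top s
        off≼s = decide-≼ k a false s (look-top s ≤-refl)
        on≼s = decide-≼ k a true s (look-top s ≤-refl)
    in
    proj₂ (computes-at (≼-trans off≼s s≼r)) (decide-look k a false s) λ (s₀ , s₀≼off , R₀) →
    let s₀≼s = ≼-trans s₀≼off off≼s
        -- Long enough to continue `σ` and to answer all queries of `R₀`, which are bounded by the
        -- code of its trace.
        l₀ = suc (σ ⊔ Run.trace R₀)
    in
    decide-path l₀ (≼-trans s₀≼s s≼r) λ (f₀ , τ₀ , t₀ , t₀≼s₀ , b₀ , lists₀) →
    let t₀≼s = ≼-trans t₀≼s₀ s₀≼s
        -- The opposite bit is chosen, but the coordinates below `k` are kept from `t₀`, so that
        -- both strings end up in the subtree at one condition.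
        m = merge k t₀ ((k , a , true) ∷ s)
        m≼on = merge-≼ (≼[]-trans (≼⇒≼[] t₀≼s) (decide-≼[] k a true s))
        m≼s = ≼-trans m≼on on≼s
    in
    proj₁ (computes-at (≼-trans m≼s s≼r)) (_≼_.keep m≼on k a (decide-look k a true s)) λ (s₁ , s₁≼m , R₁) →
    let s₁≼s = ≼-trans s₁≼m m≼s
        -- Exceeding `l₀` makes `τ₁` longer than `τ₀`, which settles one half of incompatibility;
        -- the other half is that outputs 0 and 1 differ.
        l₁ = suc (σ ⊔ l₀)
    in
    decide-path l₁ (≼-trans s₁≼s s≼r) λ (f₁ , τ₁ , t₁ , t₁≼s₁ , b₁ , lists₁) →
    let t₁≼s = ≼-trans t₁≼s₁ s₁≼s
        t₀≼r = ≼-trans t₀≼s s≼r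
        t₁≼r = ≼-trans t₁≼s s≼r
        t₁≼t₀ = ≼[]-trans (≼⇒≼[] (≼-trans t₁≼s₁ s₁≼m)) (≈⇒≼[] (merge-≈ k t₀ ((k , a , true) ∷ s)))
        q≼t₁ = ≈⇒≼[] (merge-≈ k t₁ p)
    in c record
      { p′≼p = merge-≼ (≼[]-trans (≼⇒≼[] t₁≼s) s≼p)
      ; τ₀∈S = inS t₀≼r b₀ (≼[]-trans q≼t₁ t₁≼t₀)
      ; τ₁∈S = inS t₁≼r b₁ q≼t₁
      ; σ⊑τ₀ = path-⊑ t₀≼r t₀≼s b b₀ lists₀ (m≤n⇒m≤1+n (m≤m⊔n σ (Run.trace R₀)))
      ; σ⊑τ₁ = path-⊑ t₁≼r t₁≼s b b₁ lists₁ (m≤n⇒m≤1+n (m≤m⊔n σ l₀))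
      ; τ₀⋢τ₁ = λ τ₀⊑τ₁ → case run-deterministic (Run-mono t₀≼s₀ R₀) (Run-mono t₁≼s₁ R₁)
          (s≤s (m≤n⊔m σ (Run.trace R₀))) (⊑-agree t₀≼r t₁≼r b₀ b₁ lists₀ τ₀⊑τ₁) of λ ()
      ; τ₁⋢τ₀ = λ τ₁⊑τ₀ → <-irrefl refl (proj₁ (proj₁ (lists₀ l₀ (f₁ l₀))
          (τ₁⊑τ₀ l₀ (f₁ l₀) (proj₂ (lists₁ l₀ (f₁ l₀)) (s≤s (m≤n⊔m σ l₀) , refl)))))
      }

  S-perfect : Force (Perfect X₀) [] (S ∷ []) r
  S-perfect = S-tree
    -- The empty string lies on every path and serves as the root.
    , (λ q≼r c → decide-path 0 q≼r λ (_ , τ , t , t≼q , b , _) →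
        c τ t≼q (inS (≼-trans t≼q q≼r) b (≼⇒≼[] ≼-refl)))
    , λ σ p≼r σ∈S q≼p c → split (Name.mono S q≼p σ∈S) λ splitting → let open Splitting splitting in
        c τ₀ p′≼p λ t≼q c′ → c′ τ₁ ≼-refl
          ( Name.mono S t≼q τ₀∈S , Name.mono S t≼q τ₁∈S , proj₂ ⊑-forced σ⊑τ₀ , proj₂ ⊑-forced σ⊑τ₁
          , (λ _ h → τ₀⋢τ₁ (proj₁ ⊑-forced h)) , (λ _ h → τ₁⋢τ₀ (proj₁ ⊑-forced h)))

wMPT-forced : Force wMPT [] [] p
wMPT-forced T q≼p (_ , cofinal) q′≼q c =
  -- Cofinality is applied to the first generic set beyond the support of `T`.
  ∃-elim (λ u≼q′ → cofinal (generic (Name.support T)) (≼-trans u≼q′ q′≼q)) λ (Y , s , s≼q′ , path , Y≥G) →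
  ∃-elim Y≥G λ (e , r , r≼s , reducible) →
  let open PerfectSubtree T Y e r (Force-mono (Path X₀ X₁) {[]} {Y ∷ T ∷ []} r≼s path) reducible
  in c S (≼-trans r≼s s≼q′) (S-perfect , S⊆T)

theorem5p7 : ¬ ((ACA₀ ∪ ｛ wMPT ｝) Proves ATR₀)
theorem5p7 proves = ATR₀-not-forced λ φ∈ATR₀ → sound forced (proves φ∈ATR₀) λ ()
  where
  forced : p ⊪ (ACA₀ ∪ ｛ wMPT ｝)
  forced (inj₁ φ∈ACA₀) = ACA₀-forced φ∈ACA₀
  forced (inj₂ refl) = wMPT-forced
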